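{- Let $\Delta \ge 3$ be an integer and let $G\in\mathcal{G}_\Delta$. Let $c_1,\dots,c_\Delta$ be the real numbers defined by $c_\Delta=\frac{1}{\Delta}$ and $ic_{i}+c_{i+1}=1$ for $i=1,\dots,\Delta-1$. Then $$\alpha(G)\ge \sum_{i=1}^\Delta c_i|V_i(G)|.$$
   Context: All graphs are finite, simple and undirected. $\alpha(G)$ denotes the independence number of $G$. For an integer $\Delta\ge 3$, $\mathcal{G}_\Delta$ is the set of connected graphs $G\neq K_{\Delta+1}$ with maximum degree $\Delta$. For a graph $G$ and an integer $i\ge 1$, $V_i(G)$ denotes the set of vertices of $G$ of degree $i$. -}

module Defs where

open import Data.Nat using (ℕ; zero; suc; _≤_; _∸_; _⊔_)
open import Data.Fin using (Fin)
open import Data.Bool using (Bool; true; false; not; _∧_; if_then_else_)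
open import Data.List using (List; []; _∷_; map; foldr; allFin; _++_)
open import Data.Vec using (Vec; []; _∷_; lookup)
open import Data.Product using (Σ; _×_; ∃; ∃-syntax)
open import Relation.Binary.PropositionalEquality using (_≡_; _≢_)
open import Relation.Nullary using (¬_)
open import Data.Integer using (+_)
open import Data.Rational as ℚ using (ℚ; 0ℚ; 1ℚ)

record Graph : Set where
  field
    n     : ℕ
    adj   : Fin n → Fin n → Bool
    sym   : ∀ u v → adj u v ≡ adj v u
    irrefl : ∀ v → adj v v ≡ false
open Graph public

countᵇ : {A : Set} → (A → Bool) → List A → ℕ
countᵇ p [] = 0
countᵇ p (x ∷ xs) = if p x then suc (countᵇ p xs) else countᵇ p xs

deg : (G : Graph) → Fin (n G) → ℕ
deg G v = countᵇ (adj G v) (allFin (n G))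

_==_ : ℕ → ℕ → Bool
zero == zero = true
zero == suc _ = false
suc _ == zero = false
suc a == suc b = a == b

numDeg : (G : Graph) → ℕ → ℕ
numDeg G i = countᵇ (λ v → deg G v == i) (allFin (n G))

HasMaxDegree : Graph → ℕ → Set
HasMaxDegree G Δ = (∀ v → deg G v ≤ Δ) × ∃[ v ] deg G v ≡ Δ

data Walk (G : Graph) : Fin (n G) → Fin (n G) → Set where
  here : ∀ {v} → Walk G v v
  step : ∀ {u w v} → adj G u w ≡ true → Walk G w v → Walk G u v

Connected : Graph → Set
Connected G = ∀ u v → Walk G u v

IsComplete : Graph → ℕ → Set
IsComplete G m = (n G ≡ m) × (∀ u v → u ≢ v → adj G u v ≡ true)

InClass : ℕ → Graph → Set
InClass Δ G = Connected G × HasMaxDegree G Δ × ¬ IsComplete G (suc Δ)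

allSubsets : (m : ℕ) → List (Vec Bool m)
allSubsets zero = [] ∷ []
allSubsets (suc m) = map (true ∷_) (allSubsets m) ++ map (false ∷_) (allSubsets m)

size : {m : ℕ} → Vec Bool m → ℕ
size [] = 0
size (true ∷ s) = suc (size s)
size (false ∷ s) = size s

independentᵇ : (G : Graph) → Vec Bool (n G) → Bool
independentᵇ G S =
  foldr _∧_ true (map (λ u → foldr _∧_ true
    (map (λ v → not (lookup S u ∧ lookup S v ∧ adj G u v)) (allFin (n G))))
    (allFin (n G)))

α : Graph → ℕ
α G = foldr _⊔_ 0
  (map (λ S → if independentᵇ G S then size S else 0) (allSubsets (n G)))

ℕ→ℚ : ℕ → ℚ
ℕ→ℚ k = (+ k) ℚ./ 1

-- q / k for a positive natural k (junk value 0 when k = 0; never used)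
divℕ : ℚ → ℕ → ℚ
divℕ q zero = 0ℚ
divℕ q (suc k) = q ℚ.* ((+ 1) ℚ./ suc k)

-- cAux Δ k = c_{Δ - k}, by the backward recursion
-- c_Δ = 1/Δ,  c_i = (1 - c_{i+1}) / i   (from i c_i + c_{i+1} = 1)
cAux : ℕ → ℕ → ℚ
cAux Δ zero = divℕ 1ℚ Δ
cAux Δ (suc k) = divℕ (1ℚ ℚ.- cAux Δ k) (Δ ∸ suc k)

-- c Δ i = c_i  (meaningful for 1 ≤ i ≤ Δ)
c : ℕ → ℕ → ℚ
c Δ i = cAux Δ (Δ ∸ i)

weightedSum : ℕ → Graph → ℚ
weightedSum Δ G = go Δ
  where
  go : ℕ → ℚ
  go zero = 0ℚ
  go (suc i) = go i ℚ.+ c Δ (suc i) ℚ.* ℕ→ℚ (numDeg G (suc i))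

{-# OPTIONS --safe #-}

-- Put f(S) for the sum of c_{d(v)} over v ∈ S, where d is the degree in the whole graph G, and call
-- a set S good if G[S] has an independent set of size at least f(S).
--
-- If G is not regular, every S is good. Let i be the minimum of d on S. As G is connected, some
-- v ∈ S with d(v) = i has a neighbour u that lies outside S or has d(u) > i. The sequence c is
-- nonincreasing, so the closed neighbourhood of v in S has weight at most i c_i ≤ 1 in the first case
-- and at most i c_i + c_{i+1} = 1 in the second; pick v and pass to the rest of S.
--
-- If G is regular, the claim is α(G) ≥ n/Δ, which follows from Brooks' theorem. That bound is proved
-- directly for all graphs of maximum degree at most k (k ≥ 3) without a clique on k + 1 vertices, by
-- induction on the number of vertices. It suffices to find a nonempty independent set I with
-- |N[I]| ≤ k|I|. Two nonadjacent vertices with two common neighbours form such a set. Otherwise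
-- grow I from a single vertex, keeping |N[I]| ≤ k|I| + 1, by vertices at distance 2 from I. This
-- succeeds unless the last vertices to be covered form a k-clique Q in which each vertex has exactly
-- one neighbour outside Q. If p₁ and p₂ are the outer neighbours of two vertices of Q, then
-- either one of the previous cases applies or the induction hypothesis for G − Q + p₁p₂ gives an
-- independent set missing p₁ or p₂, to which a vertex of Q can be added.
module Submission where

open import Defs hiding (sym)
open import Data.Bool using (Bool; true; false; not; _∧_; if_then_else_)
open import Data.Empty using (⊥-elim)
open import Data.Fin using (Fin; zero; suc) renaming (_≟_ to _≟ᶠ_)
open import Data.Fin.Properties using (any?)
open import Data.Fin.Subset
open import Data.Fin.Subset.Properties
open import Data.Integer as ℤ using (+_)
import Data.Integer.Properties as ℤ
open import Data.List as List using (List; []; _∷_; allFin)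
import Data.List.Membership.Propositional as List
open import Data.List.Membership.Propositional.Properties using (∈-map⁺; ∈-++⁺ˡ; ∈-++⁺ʳ)
open import Data.List.Relation.Unary.Any using (here; there)
open import Data.Nat using (ℕ; zero; suc; _+_; _*_; _∸_; _⊔_; _≤_; _<_; z≤n; s≤s; _≤?_; _<?_)
open import Data.Nat.Induction using (<-wellFounded)
open import Data.Nat.Properties hiding (_≟_)
import Data.Nat.Properties as ℕ
open import Data.Nat.Tactic.RingSolver using (solve-∀)
open import Data.Product using (∃-syntax; _×_; _,_; proj₁; proj₂)
open import Data.Rational as ℚ using (ℚ; 0ℚ; 1ℚ) renaming (_≤_ to _≤ℚ_)
import Data.Rational.Properties as ℚ
open import Data.Rational.Solver using (module +-*-Solver)
import Data.Rational.Unnormalised as ℚᵘ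
import Data.Rational.Unnormalised.Properties as ℚᵘ
open import Data.Sum using (_⊎_; inj₁; inj₂; [_,_]′)
open import Data.Vec using ([]; _∷_; here; there; lookup; tabulate)
open import Data.Vec.Properties using ([]=⇒lookup; lookup⇒[]=; lookup∘tabulate)
open import Function using (_∘_)
open import Induction.WellFounded using (Acc; acc)
open import Relation.Binary.PropositionalEquality using (_≡_; _≢_; refl; sym; trans; cong; subst; ≢-sym; module ≡-Reasoning)
open import Relation.Nullary using (Dec; yes; no; ¬_; contradiction; does)
open import Relation.Nullary.Decidable using (_×-dec_; ¬?; decidable-stable; dec-true)

-- Cardinalities of subsets

Disjoint : ∀ {n} → Subset n → Subset n → Set
Disjoint p q = ∀ {x} → x ∈ p → x ∉ q

x∈p─q⇒x∉q : ∀ {n} {x : Fin n} (p q : Subset n) → x ∈ p ─ q → x ∉ q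
x∈p─q⇒x∉q (_ ∷ p) (_ ∷ q) (there x∈) (there x∈q) = x∈p─q⇒x∉q p q x∈ x∈q

∣p∪q∣≤∣p∣+∣q∣ : ∀ {n} (p q : Subset n) → ∣ p ∪ q ∣ ≤ ∣ p ∣ + ∣ q ∣
∣p∪q∣≤∣p∣+∣q∣ [] [] = z≤n
∣p∪q∣≤∣p∣+∣q∣ (true ∷ p) (true ∷ q) =
  s≤s (≤-trans (∣p∪q∣≤∣p∣+∣q∣ p q) (+-monoʳ-≤ ∣ p ∣ (n≤1+n ∣ q ∣)))
∣p∪q∣≤∣p∣+∣q∣ (true ∷ p) (false ∷ q) = s≤s (∣p∪q∣≤∣p∣+∣q∣ p q)
∣p∪q∣≤∣p∣+∣q∣ (false ∷ p) (true ∷ q) =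
  subst (suc ∣ p ∪ q ∣ ≤_) (sym (+-suc ∣ p ∣ ∣ q ∣)) (s≤s (∣p∪q∣≤∣p∣+∣q∣ p q))
∣p∪q∣≤∣p∣+∣q∣ (false ∷ p) (false ∷ q) = ∣p∪q∣≤∣p∣+∣q∣ p q

r⊆p∪q⇒∣r∣≤∣p∣+∣q∣ : ∀ {n} {r} (p q : Subset n) → r ⊆ p ∪ q → ∣ r ∣ ≤ ∣ p ∣ + ∣ q ∣
r⊆p∪q⇒∣r∣≤∣p∣+∣q∣ p q r⊆ = ≤-trans (p⊆q⇒∣p∣≤∣q∣ r⊆) (∣p∪q∣≤∣p∣+∣q∣ p q)

disjoint⇒∣p∣+∣q∣≤∣p∪q∣ : ∀ {n} (p q : Subset n) → Disjoint p q → ∣ p ∣ + ∣ q ∣ ≤ ∣ p ∪ q ∣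
disjoint⇒∣p∣+∣q∣≤∣p∪q∣ [] [] _ = z≤n
disjoint⇒∣p∣+∣q∣≤∣p∪q∣ (true ∷ p) (true ∷ q) dis = ⊥-elim (dis here here)
disjoint⇒∣p∣+∣q∣≤∣p∪q∣ (true ∷ p) (false ∷ q) dis =
  s≤s (disjoint⇒∣p∣+∣q∣≤∣p∪q∣ p q λ x∈p x∈q → dis (there x∈p) (there x∈q))
disjoint⇒∣p∣+∣q∣≤∣p∪q∣ (false ∷ p) (true ∷ q) dis =
  subst (_≤ suc ∣ p ∪ q ∣) (sym (+-suc ∣ p ∣ ∣ q ∣))
    (s≤s (disjoint⇒∣p∣+∣q∣≤∣p∪q∣ p q λ x∈p x∈q → dis (there x∈p) (there x∈q)))
disjoint⇒∣p∣+∣q∣≤∣p∪q∣ (false ∷ p) (false ∷ q) dis =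
  disjoint⇒∣p∣+∣q∣≤∣p∪q∣ p q λ x∈p x∈q → dis (there x∈p) (there x∈q)

∪-lub : ∀ {n} {p q r : Subset n} → p ⊆ r → q ⊆ r → p ∪ q ⊆ r
∪-lub {p = p} {q} p⊆r q⊆r x∈ = [ p⊆r , q⊆r ]′ (x∈p∪q⁻ p q x∈)

⁅x⁆⊆ : ∀ {n} {x : Fin n} {p} → x ∈ p → ⁅ x ⁆ ⊆ p
⁅x⁆⊆ {x = x} {p} x∈p y∈ = subst (_∈ p) (sym (x∈⁅y⁆⇒x≡y x y∈)) x∈p

p,q⊆r⇒∣p∣+∣q∣≤∣r∣ : ∀ {n} {r} (p q : Subset n) → p ⊆ r → q ⊆ r → Disjoint p q → ∣ p ∣ + ∣ q ∣ ≤ ∣ r ∣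
p,q⊆r⇒∣p∣+∣q∣≤∣r∣ p q p⊆r q⊆r dis =
  ≤-trans (disjoint⇒∣p∣+∣q∣≤∣p∪q∣ p q dis) (p⊆q⇒∣p∣≤∣q∣ (∪-lub p⊆r q⊆r))

p⊆q∪[p─q] : ∀ {n} (p q : Subset n) → p ⊆ q ∪ (p ─ q)
p⊆q∪[p─q] p q {x} x∈p with x ∈? q
... | yes x∈q = x∈p∪q⁺ (inj₁ x∈q)
... | no  x∉q = x∈p∪q⁺ (inj₂ (x∈p∧x∉q⇒x∈p─q x∈p x∉q))

∣p∩r∣≤∣q∩r∣+∣[p─q]∩r∣ : ∀ {n} (p q r : Subset n) → ∣ p ∩ r ∣ ≤ ∣ q ∩ r ∣ + ∣ (p ─ q) ∩ r ∣
∣p∩r∣≤∣q∩r∣+∣[p─q]∩r∣ p q r = r⊆p∪q⇒∣r∣≤∣p∣+∣q∣ (q ∩ r) ((p ─ q) ∩ r) λ x∈ →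
  let x∈p , x∈r = x∈p∩q⁻ p r x∈ in
  [ (λ x∈q → x∈p∪q⁺ (inj₁ (x∈p∩q⁺ (x∈q , x∈r))))
  , (λ x∈p─q → x∈p∪q⁺ (inj₂ (x∈p∩q⁺ (x∈p─q , x∈r)))) ]′ (x∈p∪q⁻ q (p ─ q) (p⊆q∪[p─q] p q x∈p))

p⊆⁅x⁆∪q⇒∣p∣≤1+∣q∣ : ∀ {n} {p} (x : Fin n) (q : Subset n) → p ⊆ ⁅ x ⁆ ∪ q → ∣ p ∣ ≤ 1 + ∣ q ∣
p⊆⁅x⁆∪q⇒∣p∣≤1+∣q∣ x q p⊆ =
  subst (λ m → _ ≤ m + ∣ q ∣) (∣⁅x⁆∣≡1 x) (r⊆p∪q⇒∣r∣≤∣p∣+∣q∣ ⁅ x ⁆ q p⊆)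

x∈p⇒1+∣q∣≤∣p∣ : ∀ {n} {p} {x : Fin n} (q : Subset n) → x ∈ p → q ⊆ p → x ∉ q → 1 + ∣ q ∣ ≤ ∣ p ∣
x∈p⇒1+∣q∣≤∣p∣ {x = x} q x∈p q⊆p x∉q =
  subst (λ m → m + ∣ q ∣ ≤ _) (∣⁅x⁆∣≡1 x)
    (p,q⊆r⇒∣p∣+∣q∣≤∣r∣ ⁅ x ⁆ q (⁅x⁆⊆ x∈p) q⊆p
      λ y∈ y∈q → x∉q (subst (_∈ q) (x∈⁅y⁆⇒x≡y x y∈) y∈q))

x∈p⇒1≤∣p∣ : ∀ {n} {x : Fin n} {p} → x ∈ p → 1 ≤ ∣ p ∣
x∈p⇒1≤∣p∣ {x = x} x∈p = subst (_≤ _) (∣⁅x⁆∣≡1 x) (p⊆q⇒∣p∣≤∣q∣ (⁅x⁆⊆ x∈p))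

x≢y⇒2≤∣p∣ : ∀ {n} {x y : Fin n} {p} → x ∈ p → y ∈ p → x ≢ y → 2 ≤ ∣ p ∣
x≢y⇒2≤∣p∣ {x = x} {y} x∈p y∈p x≢y =
  subst (λ m → 1 + m ≤ _) (∣⁅x⁆∣≡1 y)
    (x∈p⇒1+∣q∣≤∣p∣ ⁅ y ⁆ x∈p (⁅x⁆⊆ y∈p) (x≢y⇒x∉⁅y⁆ x≢y))

∣p∣≤1⇒x≡y : ∀ {n} {x y : Fin n} {p} → ∣ p ∣ ≤ 1 → x ∈ p → y ∈ p → x ≡ y
∣p∣≤1⇒x≡y {x = x} {y} ∣p∣≤1 x∈p y∈p with x ≟ᶠ y
... | yes x≡y = x≡y
... | no  x≢y = contradiction (≤-trans (x≢y⇒2≤∣p∣ x∈p y∈p x≢y) ∣p∣≤1) λ { (s≤s ()) }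

Empty⇒∣p∣≡0 : ∀ {n} {p : Subset n} → Empty p → ∣ p ∣ ≡ 0
Empty⇒∣p∣≡0 {n} empty = trans (cong ∣_∣ (Empty-unique empty)) (∣⊥∣≡0 n)

1≤∣p∣⇒Nonempty : ∀ {n} {p : Subset n} → 1 ≤ ∣ p ∣ → Nonempty p
1≤∣p∣⇒Nonempty {p = p} 1≤ with nonempty? p
... | yes nonempty = nonempty
... | no  empty    = contradiction (subst (1 ≤_) (Empty⇒∣p∣≡0 empty) 1≤) λ ()

2≤∣p∣⇒x≢y : ∀ {n} {p : Subset n} → 2 ≤ ∣ p ∣ → ∃[ x ] ∃[ y ] x ∈ p × y ∈ p × x ≢ y
2≤∣p∣⇒x≢y {p = p} 2≤ =
  let x , x∈p = 1≤∣p∣⇒Nonempty (≤-trans (n≤1+n 1) 2≤)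
      y , y∈  = 1≤∣p∣⇒Nonempty (≤-pred (≤-trans 2≤ (p⊆⁅x⁆∪q⇒∣p∣≤1+∣q∣ x (p ─ ⁅ x ⁆) (p⊆q∪[p─q] p ⁅ x ⁆))))
  in x , y , x∈p , p─q⊆p p ⁅ x ⁆ y∈ ,
     ≢-sym (x∉⁅y⁆⇒x≢y (x∈p─q⇒x∉q p ⁅ x ⁆ y∈))

-- Graphs on a vertex subset

-- The vertex type `Fin n` never changes: an induced subgraph is given by the subset `S` that
-- accompanies `E`, and only the addition of an edge needs a new `Adjacency`.
record Adjacency (n : ℕ) : Set where
  field
    nbr        : Fin n → Subset n
    nbr-sym    : ∀ {u v} → v ∈ nbr u → u ∈ nbr v
    nbr-irrefl : ∀ {v} → v ∉ nbr v
open Adjacency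

module _ {n : ℕ} where

  Independent : Adjacency n → Subset n → Set
  Independent E J = ∀ {u v} → u ∈ J → v ∈ J → v ∉ nbr E u

  Clique : Adjacency n → Subset n → Set
  Clique E Q = ∀ {u v} → u ∈ Q → v ∈ Q → u ≢ v → v ∈ nbr E u

  Degree≤ : ℕ → Adjacency n → Subset n → Set
  Degree≤ k E S = ∀ {v} → v ∈ S → ∣ S ∩ nbr E v ∣ ≤ k

  CliqueNumber≤ : ℕ → Adjacency n → Subset n → Set
  CliqueNumber≤ k E S = ∀ {Q} → Q ⊆ S → Clique E Q → ∣ Q ∣ ≤ k

  Independence≥ : ℕ → Adjacency n → Subset n → Set
  Independence≥ k E S = ∃[ J ] J ⊆ S × Independent E J × ∣ S ∣ ≤ k * ∣ J ∣

  independent-insert : ∀ E {x J} → Independent E J → (∀ {v} → v ∈ J → v ∉ nbr E x) →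
                       Independent E (⁅ x ⁆ ∪ J)
  independent-insert E {x} {J} ind x≁J u∈ v∈ with x∈p∪q⁻ ⁅ x ⁆ J u∈ | x∈p∪q⁻ ⁅ x ⁆ J v∈
  ... | inj₂ u∈J | inj₂ v∈J = ind u∈J v∈J
  ... | inj₁ u∈x | inj₁ v∈x rewrite x∈⁅y⁆⇒x≡y x u∈x | x∈⁅y⁆⇒x≡y x v∈x = nbr-irrefl E
  ... | inj₁ u∈x | inj₂ v∈J rewrite x∈⁅y⁆⇒x≡y x u∈x = x≁J v∈J
  ... | inj₂ u∈J | inj₁ v∈x rewrite x∈⁅y⁆⇒x≡y x v∈x = λ x~u → x≁J u∈J (nbr-sym E x~u)

  -- If `u` had a non-neighbour `v ≢ u` in `O`, then `O ∩ nbr E u` would miss both `u` and `v` and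
  -- be smaller than `O` by at least two.
  dense⇒clique : ∀ E {O} → (∀ {v} → v ∈ O → ∣ O ∣ ≤ 1 + ∣ O ∩ nbr E v ∣) → Clique E O
  dense⇒clique E {O} dense {u} {v} u∈O v∈O u≢v with v ∈? nbr E u
  ... | yes v∈ = v∈
  ... | no  v∉ = ⊥-elim (<-irrefl refl (≤-trans two (dense u∈O)))
    where
    A = O ∩ nbr E u
    A⁺ = ⁅ v ⁆ ∪ A
    u∉A : u ∉ A
    u∉A u∈ = nbr-irrefl E (proj₂ (x∈p∩q⁻ O (nbr E u) u∈))
    v∉A : v ∉ A
    v∉A v∈ = v∉ (proj₂ (x∈p∩q⁻ O (nbr E u) v∈))
    two : 2 + ∣ A ∣ ≤ ∣ O ∣
    two = ≤-trans
      (s≤s (x∈p⇒1+∣q∣≤∣p∣ A (x∈p∪q⁺ (inj₁ (x∈⁅x⁆ v))) (q⊆p∪q ⁅ v ⁆ A) v∉A))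
      (x∈p⇒1+∣q∣≤∣p∣ A⁺ u∈O (∪-lub (⁅x⁆⊆ v∈O) (p∩q⊆p O (nbr E u)))
        λ u∈ → [ (λ u∈⁅v⁆ → u≢v (x∈⁅y⁆⇒x≡y v u∈⁅v⁆)) , u∉A ]′ (x∈p∪q⁻ ⁅ v ⁆ A u∈))

  module AddEdge (E : Adjacency n) {p q : Fin n} (p≢q : p ≢ q) where

    private
      -- `end a b v` is what the directed half-edge from `a` to `b` contributes to the neighbourhood
      -- of `v`; the new edge consists of two such halves.
      end : Fin n → Fin n → Fin n → Subset n
      end a b v = if does (v ≟ᶠ a) then ⁅ b ⁆ else ⊥

      end⁺ : ∀ a b → b ∈ end a b a
      end⁺ a b with a ≟ᶠ a
      ... | yes _   = x∈⁅x⁆ b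
      ... | no  a≢a = ⊥-elim (a≢a refl)

      end⁻ : ∀ a b v {w} → w ∈ end a b v → v ≡ a × w ≡ b
      end⁻ a b v w∈ with v ≟ᶠ a
      ... | yes v≡a = v≡a , x∈⁅y⁆⇒x≡y b w∈
      ... | no  _   = ⊥-elim (∉⊥ w∈)

    nbr⁺ : Fin n → Subset n
    nbr⁺ v = nbr E v ∪ (end p q v ∪ end q p v)

    old : ∀ {v w} → w ∈ nbr E v → w ∈ nbr⁺ v
    old w∈ = x∈p∪q⁺ (inj₁ w∈)

    q∈nbr⁺p : q ∈ nbr⁺ p
    q∈nbr⁺p = x∈p∪q⁺ (inj₂ (x∈p∪q⁺ (inj₁ (end⁺ p q))))

    p∈nbr⁺q : p ∈ nbr⁺ q
    p∈nbr⁺q = x∈p∪q⁺ (inj₂ (x∈p∪q⁺ (inj₂ (end⁺ q p))))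

    nbr⁺⁻ : ∀ v {w} → w ∈ nbr⁺ v → w ∈ nbr E v ⊎ (v ≡ p × w ≡ q) ⊎ (v ≡ q × w ≡ p)
    nbr⁺⁻ v w∈ with x∈p∪q⁻ (nbr E v) _ w∈
    ... | inj₁ w∈nbr = inj₁ w∈nbr
    ... | inj₂ w∈end with x∈p∪q⁻ (end p q v) (end q p v) w∈end
    ...   | inj₁ w∈₁ = inj₂ (inj₁ (end⁻ p q v w∈₁))
    ...   | inj₂ w∈₂ = inj₂ (inj₂ (end⁻ q p v w∈₂))

    addEdge : Adjacency n
    addEdge = record { nbr = nbr⁺ ; nbr-sym = nbr⁺-sym ; nbr-irrefl = nbr⁺-irrefl }
      where
      nbr⁺-sym : ∀ {u v} → v ∈ nbr⁺ u → u ∈ nbr⁺ v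
      nbr⁺-sym {u} v∈ with nbr⁺⁻ u v∈
      ... | inj₁ v∈nbr                = old (nbr-sym E v∈nbr)
      ... | inj₂ (inj₁ (refl , refl)) = p∈nbr⁺q
      ... | inj₂ (inj₂ (refl , refl)) = q∈nbr⁺p

      nbr⁺-irrefl : ∀ {v} → v ∉ nbr⁺ v
      nbr⁺-irrefl {v} v∈ with nbr⁺⁻ v v∈
      ... | inj₁ v∈nbr               = nbr-irrefl E v∈nbr
      ... | inj₂ (inj₁ (v≡p , v≡q)) = p≢q (trans (sym v≡p) v≡q)
      ... | inj₂ (inj₂ (v≡q , v≡p)) = p≢q (trans (sym v≡p) v≡q)

-- Brooks' bound

-- One step of the strong induction on `∣ S ∣`. The induction hypothesis `smaller` ranges over all
-- adjacencies because `separate` applies it to a graph with an added edge.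
module BrooksStep {n k : ℕ} (3≤k : 3 ≤ k) (E : Adjacency n) (S : Subset n)
  (Δ≤k : Degree≤ k E S) (ω≤k : CliqueNumber≤ k E S)
  (smaller : ∀ (E′ : Adjacency n) (S′ : Subset n) → ∣ S′ ∣ < ∣ S ∣ → Degree≤ k E′ S′ → CliqueNumber≤ k E′ S′ →
             Independence≥ k E′ S′) where

  open ≤-Reasoning

  smaller-⊆ : ∀ {S′} → S′ ⊆ S → ∣ S′ ∣ < ∣ S ∣ → Independence≥ k E S′
  smaller-⊆ {S′} S′⊆S <S = smaller E S′ <S
    (λ {v} v∈ → ≤-trans
      (p⊆q⇒∣p∣≤∣q∣ λ w∈ → let w∈S′ , w∈nbr = x∈p∩q⁻ S′ (nbr E v) w∈ in x∈p∩q⁺ (S′⊆S w∈S′ , w∈nbr))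
      (Δ≤k (S′⊆S v∈)))
    (λ Q⊆ → ω≤k (λ x∈ → S′⊆S (Q⊆ x∈)))

  -- `I` pays for `A` and `J` pays for `B`. With no edges between `I` and `J`, the union is
  -- independent and pays for all of `S`.
  combine : ∀ {A B I J} → S ⊆ A ∪ B → I ⊆ S → J ⊆ S → Disjoint I J →
            Independent E I → Independent E J → (∀ {u v} → u ∈ I → v ∈ J → v ∉ nbr E u) →
            ∣ A ∣ ≤ k * ∣ I ∣ → ∣ B ∣ ≤ k * ∣ J ∣ → Independence≥ k E S
  combine {A} {B} {I} {J} S⊆ I⊆S J⊆S dis indI indJ indIJ A≤ B≤ =
    I ∪ J , ∪-lub I⊆S J⊆S , ind , (begin
      ∣ S ∣                  ≤⟨ r⊆p∪q⇒∣r∣≤∣p∣+∣q∣ A B S⊆ ⟩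
      ∣ A ∣ + ∣ B ∣          ≤⟨ +-mono-≤ A≤ B≤ ⟩
      k * ∣ I ∣ + k * ∣ J ∣  ≡⟨ *-distribˡ-+ k ∣ I ∣ ∣ J ∣ ⟨
      k * (∣ I ∣ + ∣ J ∣)    ≤⟨ *-monoʳ-≤ k (disjoint⇒∣p∣+∣q∣≤∣p∪q∣ I J dis) ⟩
      k * ∣ I ∪ J ∣          ∎)
    where
    ind : Independent E (I ∪ J)
    ind u∈ v∈ with x∈p∪q⁻ I J u∈ | x∈p∪q⁻ I J v∈
    ... | inj₁ u∈I | inj₁ v∈I = indI u∈I v∈I
    ... | inj₁ u∈I | inj₂ v∈J = indIJ u∈I v∈J
    ... | inj₂ u∈J | inj₁ v∈I = λ v∈nbr → indIJ v∈I u∈J (nbr-sym E v∈nbr)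
    ... | inj₂ u∈J | inj₂ v∈J = indJ u∈J v∈J

  -- Once the error e has been reduced to 0, the set I pays for all of W and the rest of S is smaller.
  record Packing (I W : Subset n) (e : ℕ) : Set where
    field
      I⊆W    : I ⊆ W
      W⊆S    : W ⊆ S
      indep  : Independent E I
      closed : ∀ {u v} → u ∈ I → v ∈ S → v ∈ nbr E u → v ∈ W
      bound  : ∣ W ∣ ≤ e + k * ∣ I ∣
  open Packing

  -- By `closed`, no edge joins `I` to `S ─ W`, so the independent set that the induction gives
  -- there can be united with `I`. Since `W` is nonempty, `S ─ W` is smaller than `S`.
  finish : ∀ {I W} → Packing I W 0 → Nonempty W → Independence≥ k E S
  finish {I} {W} P (x , x∈W) =
    let J , J⊆ , indJ , bd = smaller-⊆ (p─q⊆p S W)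
          (p∩q≢∅⇒∣p─q∣<∣p∣ S W (x , x∈p∩q⁺ (W⊆S P x∈W , x∈W)))
        J∩W : ∀ {v} → v ∈ J → v ∉ W
        J∩W v∈J = x∈p─q⇒x∉q S W (J⊆ v∈J)
    in combine (p⊆q∪[p─q] S W) (λ u∈I → W⊆S P (I⊆W P u∈I)) (λ v∈J → p─q⊆p S W (J⊆ v∈J))
         (λ u∈I u∈J → J∩W u∈J (I⊆W P u∈I))
         (indep P) indJ
         (λ u∈I v∈J v∈nbr → J∩W v∈J (closed P u∈I (p─q⊆p S W (J⊆ v∈J)) v∈nbr))
         (bound P) bd

  N[_] : Fin n → Subset n
  N[ x ] = ⁅ x ⁆ ∪ (S ∩ nbr E x)

  x∈N[x] : ∀ x → x ∈ N[ x ]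
  x∈N[x] x = x∈p∪q⁺ (inj₁ (x∈⁅x⁆ x))

  nbr⊆N : ∀ {x v} → v ∈ S → v ∈ nbr E x → v ∈ N[ x ]
  nbr⊆N v∈S v∈nbr = x∈p∪q⁺ (inj₂ (x∈p∩q⁺ (v∈S , v∈nbr)))

  ∈N⁻ : ∀ x {v} → v ∈ N[ x ] → v ≡ x ⊎ (v ∈ S × v ∈ nbr E x)
  ∈N⁻ x v∈ with x∈p∪q⁻ ⁅ x ⁆ (S ∩ nbr E x) v∈
  ... | inj₁ v∈⁅x⁆ = inj₁ (x∈⁅y⁆⇒x≡y x v∈⁅x⁆)
  ... | inj₂ v∈S∩  = inj₂ (x∈p∩q⁻ S (nbr E x) v∈S∩)

  -- Taking `x` brings `x` and its neighbours outside `W` into `W` and raises the allowance by `k`;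
  -- `gain` compares the two. The set stays independent because a neighbour of `I` in `S` would
  -- already lie in `W`.
  extend : ∀ {I W e e′ x} → Packing I W e → x ∈ S → x ∉ W →
           e + (1 + ∣ (S ∩ nbr E x) ─ W ∣) ≤ k + e′ → Packing (⁅ x ⁆ ∪ I) (W ∪ N[ x ]) e′
  extend {I} {W} {e} {e′} {x} P x∈S x∉W gain = record
    { I⊆W = ∪-lub (⁅x⁆⊆ (x∈p∪q⁺ (inj₂ (x∈N[x] x)))) (λ u∈I → x∈p∪q⁺ (inj₁ (I⊆W P u∈I)))
    ; W⊆S = ∪-lub (W⊆S P) (∪-lub (⁅x⁆⊆ x∈S) (p∩q⊆p S (nbr E x)))
    ; indep = independent-insert E (indep P) (λ v∈I v~x → x∉nbr v∈I (nbr-sym E v~x))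
    ; closed = cl
    ; bound = begin
        ∣ W ∪ N[ x ] ∣                    ≤⟨ r⊆p∪q⇒∣r∣≤∣p∣+∣q∣ W new⁺ W∪N⊆ ⟩
        ∣ W ∣ + ∣ new⁺ ∣                  ≤⟨ +-mono-≤ (bound P) (p⊆⁅x⁆∪q⇒∣p∣≤1+∣q∣ x new ⊆-refl) ⟩
        e + k * ∣ I ∣ + (1 + ∣ new ∣)     ≡⟨ swap₁ e (k * ∣ I ∣) (1 + ∣ new ∣) ⟩
        e + (1 + ∣ new ∣) + k * ∣ I ∣     ≤⟨ +-monoˡ-≤ (k * ∣ I ∣) gain ⟩
        k + e′ + k * ∣ I ∣                ≡⟨ swap₂ k e′ ∣ I ∣ ⟩
        e′ + k * (1 + ∣ I ∣)              ≤⟨ +-monoʳ-≤ e′ (*-monoʳ-≤ k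
                                               (x∈p⇒1+∣q∣≤∣p∣ I (x∈p∪q⁺ (inj₁ (x∈⁅x⁆ x))) (q⊆p∪q ⁅ x ⁆ I)
                                                 (λ x∈I → x∉W (I⊆W P x∈I)))) ⟩
        e′ + k * ∣ ⁅ x ⁆ ∪ I ∣            ∎
    }
    where
    new  = (S ∩ nbr E x) ─ W
    new⁺ = ⁅ x ⁆ ∪ new
    swap₁ : ∀ a b c → a + b + c ≡ a + c + b
    swap₁ = solve-∀
    swap₂ : ∀ a b c → a + b + a * c ≡ b + a * (1 + c)
    swap₂ = solve-∀
    W∪N⊆ : W ∪ N[ x ] ⊆ W ∪ new⁺
    W∪N⊆ = ∪-lub (p⊆p∪q new⁺)
      (∪-lub (λ v∈ → x∈p∪q⁺ (inj₂ (x∈p∪q⁺ (inj₁ v∈))))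
             (λ v∈ → [ (λ v∈W → x∈p∪q⁺ (inj₁ v∈W)) , (λ v∈new → x∈p∪q⁺ (inj₂ (x∈p∪q⁺ (inj₂ v∈new)))) ]′
                     (x∈p∪q⁻ W new (p⊆q∪[p─q] (S ∩ nbr E x) W v∈))))
    x∉nbr : ∀ {u} → u ∈ I → x ∉ nbr E u
    x∉nbr u∈I x∈nbr = x∉W (closed P u∈I x∈S x∈nbr)
    cl : ∀ {u v} → u ∈ ⁅ x ⁆ ∪ I → v ∈ S → v ∈ nbr E u → v ∈ W ∪ N[ x ]
    cl u∈ v∈S v∈nbr with x∈p∪q⁻ ⁅ x ⁆ I u∈
    ... | inj₂ u∈I = x∈p∪q⁺ (inj₁ (closed P u∈I v∈S v∈nbr))
    ... | inj₁ u∈x rewrite x∈⁅y⁆⇒x≡y x u∈x = x∈p∪q⁺ (inj₂ (nbr⊆N v∈S v∈nbr))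

  ∣new∣+∣old∣≤k : ∀ {W x} → W ⊆ S → x ∈ S → ∣ (S ∩ nbr E x) ─ W ∣ + ∣ W ∩ nbr E x ∣ ≤ k
  ∣new∣+∣old∣≤k {W} {x} W⊆S x∈S = ≤-trans
    (p,q⊆r⇒∣p∣+∣q∣≤∣r∣ _ _ (p─q⊆p (S ∩ nbr E x) W)
      (λ v∈ → let v∈W , v∈nbr = x∈p∩q⁻ W (nbr E x) v∈ in x∈p∩q⁺ (W⊆S v∈W , v∈nbr))
      (λ v∈ v∈W∩ → x∈p─q⇒x∉q (S ∩ nbr E x) W v∈ (p∩q⊆p W (nbr E x) v∈W∩)))
    (Δ≤k x∈S)

  -- Each neighbour of `x` already in `W` is one vertex fewer to pay for. So one such neighbour
  -- keeps the error at 1, and two reduce it from 1 to 0.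
  extend-by : ∀ {I W e e′ x} → Packing I W e → x ∈ S → x ∉ W →
              e + 1 ≤ e′ + ∣ W ∩ nbr E x ∣ → Packing (⁅ x ⁆ ∪ I) (W ∪ N[ x ]) e′
  extend-by {I} {W} {e} {e′} {x} P x∈S x∉W gain = extend P x∈S x∉W (begin
    e + (1 + t)  ≡⟨ +-assoc e 1 t ⟨
    e + 1 + t    ≤⟨ +-monoˡ-≤ t gain ⟩
    e′ + r + t   ≡⟨ lem e′ r t ⟩
    t + r + e′   ≤⟨ +-monoˡ-≤ e′ (∣new∣+∣old∣≤k (W⊆S P) x∈S) ⟩
    k + e′       ∎)
    where
    t = ∣ (S ∩ nbr E x) ─ W ∣
    r = ∣ W ∩ nbr E x ∣
    lem : ∀ a b c → a + b + c ≡ c + b + a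
    lem = solve-∀

  empty : Packing ⊥ ⊥ 0
  empty = record
    { I⊆W = λ u∈ → u∈ ; W⊆S = λ u∈ → ⊥-elim (∉⊥ u∈)
    ; indep = λ u∈ → ⊥-elim (∉⊥ u∈) ; closed = λ u∈ → ⊥-elim (∉⊥ u∈)
    ; bound = ≤-trans (≤-reflexive (∣⊥∣≡0 n)) z≤n }

  single : ∀ {x} → x ∈ S → Packing (⁅ x ⁆ ∪ ⊥) (⊥ ∪ N[ x ]) 1
  single x∈S = extend-by empty x∈S ∉⊥ (m≤m+n 1 _)

  -- Here `N[ x ]` has at most `k` vertices, so `x` alone pays for it without error.
  lowDegree : ∀ {x} → x ∈ S → ∣ S ∩ nbr E x ∣ < k → Independence≥ k E S
  lowDegree {x} x∈S d<k = finish
    (extend empty x∈S ∉⊥ (begin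
      1 + ∣ (S ∩ nbr E x) ─ ⊥ ∣  ≤⟨ s≤s (∣p─q∣≤∣p∣ (S ∩ nbr E x) ⊥) ⟩
      1 + ∣ S ∩ nbr E x ∣        ≤⟨ d<k ⟩
      k                          ≡⟨ +-identityʳ k ⟨
      k + 0                      ∎))
    (x , x∈p∪q⁺ (inj₂ (x∈N[x] x)))

  -- Start from `N[ a ]` with error 1. The vertex `b` lies outside it and has the two neighbours `c`
  -- and `d` inside, which brings the error to 0.
  twoCommon : ∀ {a b c d} → a ∈ S → b ∈ S → a ≢ b → b ∉ nbr E a →
              c ∈ S → d ∈ S → c ≢ d → c ∈ nbr E a → c ∈ nbr E b → d ∈ nbr E a → d ∈ nbr E b →
              Independence≥ k E S
  twoCommon {a} {b} a∈S b∈S a≢b b∉ c∈S d∈S c≢d c∈a c∈b d∈a d∈b = finish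
    (extend-by (single a∈S) b∈S
      (λ b∈ → [ (λ b∈⊥ → ∉⊥ b∈⊥)
              , (λ b∈N → [ (λ b≡a → a≢b (sym b≡a)) , (λ { (_ , b∈nbr) → b∉ b∈nbr }) ]′ (∈N⁻ a b∈N)) ]′
              (x∈p∪q⁻ ⊥ N[ a ] b∈))
      (x≢y⇒2≤∣p∣ {p = (⊥ ∪ N[ a ]) ∩ nbr E b} (x∈p∩q⁺ (x∈p∪q⁺ (inj₂ (nbr⊆N c∈S c∈a)) , c∈b))
                 (x∈p∩q⁺ (x∈p∪q⁺ (inj₂ (nbr⊆N d∈S d∈a)) , d∈b)) c≢d))
    (b , x∈p∪q⁺ (inj₂ (x∈N[x] b)))

  -- The only way in which a packing can grow to all of S with error 1: see Regular.grow.
  record PendantClique (Q : Subset n) : Set where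
    field
      Q⊆S    : Q ⊆ S
      clique : Clique E Q
      ∣Q∣≤k  : ∣ Q ∣ ≤ k
      k≤∣Q∣  : k ≤ ∣ Q ∣
      outer  : ∀ {q} → q ∈ Q → Nonempty ((S ─ Q) ∩ nbr E q)
      outer≤ : ∀ {q} → q ∈ Q → ∣ (S ─ Q) ∩ nbr E q ∣ ≤ 1
  open PendantClique

  pendantClique⇒ : ∀ {Q} → PendantClique Q → Independence≥ k E S
  pendantClique⇒ {Q} C = result
    where
    O : Subset n
    O = S ─ Q

    record Pair : Set where
      constructor pair
      field
        {q p} : Fin n
        q∈Q : q ∈ Q
        p∈O : p ∈ O
        p~q : p ∈ nbr E q
        only : ∀ {v} → v ∈ O → v ∈ nbr E q → v ≡ p
    open Pair

    pairOf : ∀ {q} → q ∈ Q → Pair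
    pairOf {q} q∈Q =
      let p , p∈ = outer C q∈Q
          p∈O , p~q = x∈p∩q⁻ O (nbr E q) p∈
      in pair q∈Q p∈O p~q (λ v∈O v~q → ∣p∣≤1⇒x≡y (outer≤ C q∈Q) (x∈p∩q⁺ (v∈O , v~q)) p∈)

    O⊆S : O ⊆ S
    O⊆S = p─q⊆p S Q

    O∩Q : ∀ {v} → v ∈ O → v ∉ Q
    O∩Q = x∈p─q⇒x∉q S Q

    -- If `p` were adjacent to all of `Q`, the set `⁅ p ⁆ ∪ Q` would be a clique on more than `k`
    -- vertices. Otherwise some `r` in `Q` is not adjacent to `p`, and `r` and `p` have the common
    -- neighbours `q₁` and `q₂`.
    sameOuter : ∀ {p q₁ q₂} → p ∈ O → q₁ ∈ Q → q₂ ∈ Q → q₁ ≢ q₂ → p ∈ nbr E q₁ → p ∈ nbr E q₂ →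
                Independence≥ k E S
    sameOuter {p} {q₁} {q₂} p∈O q₁∈Q q₂∈Q q₁≢q₂ p~q₁ p~q₂ with nonempty? (Q ─ nbr E p)
    ... | no all = ⊥-elim (<-irrefl refl (begin
        1 + k            ≤⟨ s≤s (k≤∣Q∣ C) ⟩
        1 + ∣ Q ∣        ≤⟨ x∈p⇒1+∣q∣≤∣p∣ Q (x∈p∪q⁺ (inj₁ (x∈⁅x⁆ p))) (q⊆p∪q ⁅ p ⁆ Q) (O∩Q p∈O) ⟩
        ∣ ⁅ p ⁆ ∪ Q ∣    ≤⟨ ω≤k (∪-lub (⁅x⁆⊆ (O⊆S p∈O)) (Q⊆S C)) cl ⟩
        k                ∎))
      where
      Q⊆nbr : ∀ {v} → v ∈ Q → v ∈ nbr E p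
      Q⊆nbr {v} v∈Q with v ∈? nbr E p
      ... | yes v∈ = v∈
      ... | no v∉ = ⊥-elim (all (v , x∈p∧x∉q⇒x∈p─q v∈Q v∉))
      cl : Clique E (⁅ p ⁆ ∪ Q)
      cl u∈ v∈ u≢v with x∈p∪q⁻ ⁅ p ⁆ Q u∈ | x∈p∪q⁻ ⁅ p ⁆ Q v∈
      ... | inj₂ u∈Q | inj₂ v∈Q = clique C u∈Q v∈Q u≢v
      ... | inj₁ u∈p | inj₁ v∈p = ⊥-elim (u≢v (trans (x∈⁅y⁆⇒x≡y p u∈p) (sym (x∈⁅y⁆⇒x≡y p v∈p))))
      ... | inj₁ u∈p | inj₂ v∈Q rewrite x∈⁅y⁆⇒x≡y p u∈p = Q⊆nbr v∈Q
      ... | inj₂ u∈Q | inj₁ v∈p rewrite x∈⁅y⁆⇒x≡y p v∈p = nbr-sym E (Q⊆nbr u∈Q)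
    ... | yes (r , r∈) = twoCommon (Q⊆S C r∈Q) (O⊆S p∈O) r≢p p≁r
          (Q⊆S C q₁∈Q) (Q⊆S C q₂∈Q) q₁≢q₂
          (clique C r∈Q q₁∈Q λ { refl → p≁r p~q₁ }) (nbr-sym E p~q₁)
          (clique C r∈Q q₂∈Q λ { refl → p≁r p~q₂ }) (nbr-sym E p~q₂)
      where
      r∈Q : r ∈ Q
      r∈Q = p─q⊆p Q (nbr E p) r∈
      r≢p : r ≢ p
      r≢p refl = O∩Q p∈O r∈Q
      p≁r : p ∉ nbr E r
      p≁r p∈ = x∈p─q⇒x∉q Q (nbr E p) r∈ (nbr-sym E p∈)

    -- The only neighbour of `q P` in `O` is `p P`, which `J` misses, so `q P` can be added to `J`.
    -- It pays for `Q`, which has at most `k` vertices.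
    addPendant : ∀ {J} → J ⊆ O → Independent E J → ∣ O ∣ ≤ k * ∣ J ∣ → (P : Pair) → p P ∉ J →
                 Independence≥ k E S
    addPendant {J} J⊆O indJ bd P p∉J = combine {I = ⁅ q P ⁆} (p⊆q∪[p─q] S Q)
      (⁅x⁆⊆ (Q⊆S C (q∈Q P))) (λ v∈J → O⊆S (J⊆O v∈J))
      (λ u∈ u∈J → O∩Q (J⊆O u∈J) (⁅x⁆⊆ (q∈Q P) u∈))
      (λ u∈ v∈ → refl-≁ (x∈⁅y⁆⇒x≡y _ u∈) (x∈⁅y⁆⇒x≡y _ v∈))
      indJ
      (λ {u} {v} u∈ v∈J v~u → p∉J (subst (_∈ J)
        (only P (J⊆O v∈J) (subst (λ z → v ∈ nbr E z) (x∈⁅y⁆⇒x≡y _ u∈) v~u)) v∈J))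
      (begin
        ∣ Q ∣           ≤⟨ ∣Q∣≤k C ⟩
        k               ≡⟨ *-identityʳ k ⟨
        k * 1           ≡⟨ cong (k *_) (∣⁅x⁆∣≡1 (q P)) ⟨
        k * ∣ ⁅ q P ⁆ ∣ ∎)
      bd
      where
      refl-≁ : ∀ {u v x} → u ≡ x → v ≡ x → v ∉ nbr E u
      refl-≁ refl refl = nbr-irrefl E

    -- Joining the outer neighbours p₁ and p₂ by an edge forces an independent set of S ─ Q to miss
    -- one of them, so that the corresponding vertex of Q can be added.
    separate : (P₁ P₂ : Pair) → p P₁ ≢ p P₂ → p P₂ ∉ nbr E (p P₁) →
               Independence≥ k E S
    separate P₁ P₂ p₁≢p₂ p₁≁p₂ with 2 ≤? ∣ (S ∩ nbr E (p P₁)) ∩ nbr E (p P₂) ∣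
    ... | yes 2≤ =
      let c , d , c∈ , d∈ , c≢d = 2≤∣p∣⇒x≢y 2≤
          c∈₁ , c~p₂ = x∈p∩q⁻ (S ∩ nbr E (p P₁)) _ c∈
          d∈₁ , d~p₂ = x∈p∩q⁻ (S ∩ nbr E (p P₁)) _ d∈
          c∈S , c~p₁ = x∈p∩q⁻ S _ c∈₁
          d∈S , d~p₁ = x∈p∩q⁻ S _ d∈₁
      in twoCommon (O⊆S (p∈O P₁)) (O⊆S (p∈O P₂)) p₁≢p₂ p₁≁p₂ c∈S d∈S c≢d c~p₁ c~p₂ d~p₁ d~p₂
    ... | no ¬2≤ =
      let J , J⊆O , indJ , bd = smaller addEdge O <S degree cliqueNumber
      in addOne J⊆O indJ bd (p P₁ ∈? J) (p P₂ ∈? J)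
      where
      open AddEdge E p₁≢p₂
      common = (S ∩ nbr E (p P₁)) ∩ nbr E (p P₂)
      addOne : ∀ {J} → J ⊆ O → Independent addEdge J → ∣ O ∣ ≤ k * ∣ J ∣ →
               Dec (p P₁ ∈ J) → Dec (p P₂ ∈ J) → Independence≥ k E S
      addOne J⊆O indJ bd (no p₁∉) _         = addPendant J⊆O (λ u∈ v∈ v~u → indJ u∈ v∈ (old v~u)) bd P₁ p₁∉
      addOne J⊆O indJ bd _        (no p₂∉)  = addPendant J⊆O (λ u∈ v∈ v~u → indJ u∈ v∈ (old v~u)) bd P₂ p₂∉
      addOne J⊆O indJ bd (yes p₁∈) (yes p₂∈) = ⊥-elim (indJ p₁∈ p₂∈ q∈nbr⁺p)
      <S : ∣ O ∣ < ∣ S ∣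
      <S = p∩q≢∅⇒∣p─q∣<∣p∣ S Q (q P₁ , x∈p∩q⁺ (Q⊆S C (q∈Q P₁) , q∈Q P₁))
      -- The end `p P` gains the neighbour `z` but loses its neighbour `q P`, which lies in the
      -- deleted `Q`.
      endDegree : (P : Pair) (z : Fin n) → (∀ {w} → w ∈ nbr⁺ (p P) → w ∈ nbr E (p P) ⊎ w ≡ z) →
                  ∣ O ∩ nbr⁺ (p P) ∣ ≤ k
      endDegree P z new = begin
        ∣ O ∩ nbr⁺ (p P) ∣       ≤⟨ p⊆⁅x⁆∪q⇒∣p∣≤1+∣q∣ z (O ∩ nbr E (p P)) (λ w∈ →
                                     let w∈O , w~ = x∈p∩q⁻ O _ w∈ in
                                     [ (λ w~p → x∈p∪q⁺ (inj₂ (x∈p∩q⁺ (w∈O , w~p))))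
                                     , (λ { refl → x∈p∪q⁺ (inj₁ (x∈⁅x⁆ z)) }) ]′ (new w~)) ⟩
        1 + ∣ O ∩ nbr E (p P) ∣  ≤⟨ x∈p⇒1+∣q∣≤∣p∣ _ (x∈p∩q⁺ (Q⊆S C (q∈Q P) , nbr-sym E (p~q P)))
                                     (λ w∈ → let w∈O , w~ = x∈p∩q⁻ O _ w∈ in x∈p∩q⁺ (O⊆S w∈O , w~))
                                     (λ q∈ → O∩Q (p∩q⊆p O _ q∈) (q∈Q P)) ⟩
        ∣ S ∩ nbr E (p P) ∣      ≤⟨ Δ≤k (O⊆S (p∈O P)) ⟩
        k                        ∎
      degree : Degree≤ k addEdge O
      degree {v} v∈O = go (v ≟ᶠ p P₁) (v ≟ᶠ p P₂)
        where
        go : Dec (v ≡ p P₁) → Dec (v ≡ p P₂) → ∣ O ∩ nbr⁺ v ∣ ≤ k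
        go (yes refl) _ = endDegree P₁ (p P₂) λ w∈ →
              [ inj₁ , [ (λ { (_ , w≡) → inj₂ w≡ }) , (λ { (p₁≡p₂ , _) → ⊥-elim (p₁≢p₂ p₁≡p₂) }) ]′ ]′ (nbr⁺⁻ _ w∈)
        go (no _) (yes refl) = endDegree P₂ (p P₁) λ w∈ →
              [ inj₁ , [ (λ { (p₂≡p₁ , _) → ⊥-elim (p₁≢p₂ (sym p₂≡p₁)) }) , (λ { (_ , w≡) → inj₂ w≡ }) ]′ ]′ (nbr⁺⁻ _ w∈)
        go (no v≢p₁) (no v≢p₂) = ≤-trans
              (p⊆q⇒∣p∣≤∣q∣ λ w∈ → let w∈O , w~ = x∈p∩q⁻ O _ w∈ in x∈p∩q⁺ (O⊆S w∈O ,
                [ (λ w~v → w~v) , [ (λ { (v≡ , _) → ⊥-elim (v≢p₁ v≡) }) , (λ { (v≡ , _) → ⊥-elim (v≢p₂ v≡) }) ]′ ]′ (nbr⁺⁻ v w~)))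
              (Δ≤k (O⊆S v∈O))
      -- A clique that misses one of the two ends does not use the new edge. One that contains both
      -- has, besides them, only common neighbours of the ends; there is at most one of these, so
      -- its size is at most 3, and `3≤k` applies.
      cliqueNumber : CliqueNumber≤ k addEdge O
      cliqueNumber {K} K⊆O cl with p P₁ ∈? K ×-dec p P₂ ∈? K
      ... | no ¬both = ω≤k (λ v∈K → O⊆S (K⊆O v∈K)) λ {u} u∈ v∈ u≢v →
              [ (λ v~u → v~u)
              , [ (λ { (refl , refl) → ⊥-elim (¬both (u∈ , v∈)) })
                , (λ { (refl , refl) → ⊥-elim (¬both (v∈ , u∈)) }) ]′ ]′ (nbr⁺⁻ u (cl u∈ v∈ u≢v))
      ... | yes (p₁∈K , p₂∈K) = begin
              ∣ K ∣                                  ≤⟨ p⊆⁅x⁆∪q⇒∣p∣≤1+∣q∣ (p P₁) _ K⊆ ⟩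
              1 + ∣ ⁅ p P₂ ⁆ ∪ common ∣              ≤⟨ s≤s (p⊆⁅x⁆∪q⇒∣p∣≤1+∣q∣ (p P₂) common ⊆-refl) ⟩
              2 + ∣ common ∣                         ≤⟨ +-monoʳ-≤ 2 (≤-pred (≰⇒> ¬2≤)) ⟩
              3                                      ≤⟨ 3≤k ⟩
              k                                      ∎
        where
        K⊆ : K ⊆ ⁅ p P₁ ⁆ ∪ (⁅ p P₂ ⁆ ∪ common)
        K⊆ {v} v∈K with v ≟ᶠ p P₁ | v ≟ᶠ p P₂
        ... | yes refl | _ = x∈p∪q⁺ (inj₁ (x∈⁅x⁆ v))
        ... | no _ | yes refl = x∈p∪q⁺ (inj₂ (x∈p∪q⁺ (inj₁ (x∈⁅x⁆ v))))
        ... | no v≢p₁ | no v≢p₂ = x∈p∪q⁺ (inj₂ (x∈p∪q⁺ (inj₂ (x∈p∩q⁺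
              ( x∈p∩q⁺ (O⊆S (K⊆O v∈K) ,
                 [ (λ v~ → v~) , [ (λ { (_ , v≡) → ⊥-elim (v≢p₂ v≡) }) , (λ { (p₁≡ , _) → ⊥-elim (p₁≢p₂ p₁≡) }) ]′ ]′
                   (nbr⁺⁻ _ (cl p₁∈K v∈K (≢-sym v≢p₁))))
              , [ (λ v~ → v~) , [ (λ { (p₂≡ , _) → ⊥-elim (p₁≢p₂ (sym p₂≡)) }) , (λ { (_ , v≡) → ⊥-elim (v≢p₁ v≡) }) ]′ ]′
                   (nbr⁺⁻ _ (cl p₂∈K v∈K (≢-sym v≢p₂))))))))

    distinct : (P₁ P₂ : Pair) → q P₁ ≢ q P₂ → Independence≥ k E S
    distinct P₁ P₂ q₁≢q₂ with p P₁ ≟ᶠ p P₂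
    ... | yes p₁≡p₂ = sameOuter (p∈O P₁) (q∈Q P₁) (q∈Q P₂) q₁≢q₂ (p~q P₁)
                        (subst (_∈ nbr E (q P₂)) (sym p₁≡p₂) (p~q P₂))
    ... | no p₁≢p₂ with p P₂ ∈? nbr E (p P₁)
    ...   | no p₁≁p₂ = separate P₁ P₂ p₁≢p₂ p₁≁p₂
    -- The vertices `q P₁`, `q P₂`, `p P₂`, `p P₁` form a 4-cycle in which `q P₁` and `p P₂` are
    -- opposite; they are not adjacent, since the only neighbour of `q P₁` in `O` is `p P₁`.
    ...   | yes p₁~p₂ = twoCommon (Q⊆S C (q∈Q P₁)) (O⊆S (p∈O P₂))
              (λ { q₁≡p₂ → O∩Q (p∈O P₂) (subst (_∈ Q) q₁≡p₂ (q∈Q P₁)) })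
              (λ p₂~q₁ → p₁≢p₂ (sym (only P₁ (p∈O P₂) p₂~q₁)))
              (Q⊆S C (q∈Q P₂)) (O⊆S (p∈O P₁))
              (λ q₂≡p₁ → O∩Q (p∈O P₁) (subst (_∈ Q) q₂≡p₁ (q∈Q P₂)))
              (clique C (q∈Q P₁) (q∈Q P₂) q₁≢q₂) (nbr-sym E (p~q P₂))
              (p~q P₁) (nbr-sym E p₁~p₂)

    result : Independence≥ k E S
    result =
      let q₁ , q₂ , q₁∈ , q₂∈ , q₁≢q₂ = 2≤∣p∣⇒x≢y (≤-trans (≤-trans (n≤1+n 2) 3≤k) (k≤∣Q∣ C))
      in distinct (pairOf q₁∈) (pairOf q₂∈) q₁≢q₂

  module Regular (k≤d : ∀ {v} → v ∈ S → k ≤ ∣ S ∩ nbr E v ∣) where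

    -- Induction on the bound `m` for the number of uncovered vertices. An uncovered vertex with two
    -- neighbours in `W` removes the error; one with a single neighbour in `W` enlarges `W` and
    -- keeps the error at 1.
    grow : ∀ m {I W} → ∣ S ─ W ∣ ≤ m → Packing I W 1 → Nonempty W → Nonempty (S ─ W) →
           Independence≥ k E S
    grow zero ∣O∣≤0 _ _ (_ , y∈O) = contradiction (≤-trans (x∈p⇒1≤∣p∣ y∈O) ∣O∣≤0) λ ()
    grow (suc m) {I} {W} ∣O∣≤ P (w , w∈W) (y , y∈O)
      with any? (λ x → x ∈? (S ─ W) ×-dec 2 ≤? ∣ W ∩ nbr E x ∣)
    ... | yes (x , x∈O , 2≤) = finish
            (extend-by P (p─q⊆p S W x∈O) (x∈p─q⇒x∉q S W x∈O) 2≤) (w , x∈p∪q⁺ (inj₁ w∈W))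
    ... | no ¬2≤ with any? (λ x → x ∈? (S ─ W) ×-dec 1 ≤? ∣ W ∩ nbr E x ∣)
    -- No edge leaves W, so W and S ─ W can be treated separately.
    ...   | no ¬1≤ =
            let I₁ , I₁⊆ , ind₁ , bd₁ = smaller-⊆ (W⊆S P)
                  (x∈p⇒1+∣q∣≤∣p∣ W (p─q⊆p S W y∈O) (W⊆S P) (x∈p─q⇒x∉q S W y∈O))
                I₂ , I₂⊆ , ind₂ , bd₂ = smaller-⊆ (p─q⊆p S W)
                  (p∩q≢∅⇒∣p─q∣<∣p∣ S W (w , x∈p∩q⁺ (W⊆S P w∈W , w∈W)))
            in combine (p⊆q∪[p─q] S W) (λ u∈ → W⊆S P (I₁⊆ u∈)) (λ u∈ → p─q⊆p S W (I₂⊆ u∈))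
                 (λ u∈₁ u∈₂ → x∈p─q⇒x∉q S W (I₂⊆ u∈₂) (I₁⊆ u∈₁)) ind₁ ind₂
                 (λ {u} {v} u∈₁ v∈₂ v~u → ¬1≤ (v , I₂⊆ v∈₂ ,
                    x∈p⇒1≤∣p∣ (x∈p∩q⁺ (I₁⊆ u∈₁ , nbr-sym E v~u))))
                 bd₁ bd₂
    ...   | yes (x , x∈O , 1≤) with nonempty? (S ─ (W ∪ N[ x ]))
    ...     | yes more = grow m
                (≤-pred (≤-trans (x∈p⇒1+∣q∣≤∣p∣ (S ─ (W ∪ N[ x ])) x∈O
                  (λ v∈ → x∈p∧x∉q⇒x∈p─q (p─q⊆p S (W ∪ N[ x ]) v∈) (λ v∈W → x∈p─q⇒x∉q S (W ∪ N[ x ]) v∈ (x∈p∪q⁺ (inj₁ v∈W))))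
                  (λ x∈ → x∈p─q⇒x∉q S (W ∪ N[ x ]) x∈ (x∈p∪q⁺ (inj₂ (x∈N[x] x))))) ∣O∣≤))
                (extend-by P (p─q⊆p S W x∈O) (x∈p─q⇒x∉q S W x∈O) (s≤s 1≤))
                (w , x∈p∪q⁺ (inj₁ w∈W)) more
    -- Taking `x` would cover all of `S`. Each vertex of `O` has at most one neighbour in `W`, hence
    -- at least `k ∸ 1` in `O`, while `∣ O ∣ ≤ k`; this makes `O` a clique on exactly `k` vertices.
    ...     | no none = pendantClique⇒ {O} record
                { Q⊆S = p─q⊆p S W
                ; clique = dense⇒clique E (λ v∈O → ≤-trans O≤k (inner v∈O))
                ; ∣Q∣≤k = O≤k
                ; k≤∣Q∣ = ≤-trans (inner x∈O) (inner≤ x∈O)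
                ; outer = λ v∈O → 1≤∣p∣⇒Nonempty (1≤outer v∈O)
                ; outer≤ = λ {v} v∈O → ≤-trans
                    (p⊆q⇒∣p∣≤∣q∣ λ u∈ → let u∈S─O , u~v = x∈p∩q⁻ (S ─ O) _ u∈ in x∈p∩q⁺ (S─O⊆W u∈S─O , u~v))
                    (≤1 v∈O)
                }
      where
      O = S ─ W
      O⊆S : O ⊆ S
      O⊆S = p─q⊆p S W
      ≤1 : ∀ {v} → v ∈ O → ∣ W ∩ nbr E v ∣ ≤ 1
      ≤1 v∈O = ≤-pred (≰⇒> λ 2≤ → ¬2≤ (_ , v∈O , 2≤))
      S─O⊆W : S ─ O ⊆ W
      S─O⊆W {v} v∈ with v ∈? W
      ... | yes v∈W = v∈W
      ... | no v∉W = ⊥-elim (x∈p─q⇒x∉q S O v∈ (x∈p∧x∉q⇒x∈p─q (p─q⊆p S O v∈) v∉W))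
      O⊆ : O ⊆ ⁅ x ⁆ ∪ ((S ∩ nbr E x) ─ W)
      O⊆ {v} v∈O with v ∈? (W ∪ N[ x ])
      ... | no v∉ = ⊥-elim (none (v , x∈p∧x∉q⇒x∈p─q (O⊆S v∈O) v∉))
      ... | yes v∈ with x∈p∪q⁻ W N[ x ] v∈
      ...   | inj₁ v∈W = ⊥-elim (x∈p─q⇒x∉q S W v∈O v∈W)
      ...   | inj₂ v∈N with x∈p∪q⁻ ⁅ x ⁆ (S ∩ nbr E x) v∈N
      ...     | inj₁ v∈x = x∈p∪q⁺ (inj₁ v∈x)
      ...     | inj₂ v∈S∩ = x∈p∪q⁺ (inj₂ (x∈p∧x∉q⇒x∈p─q v∈S∩ (x∈p─q⇒x∉q S W v∈O)))
      O≤k : ∣ O ∣ ≤ k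
      -- `O` consists of `x` and neighbours of `x` outside `W`, and at least one of the at most `k`
      -- neighbours of `x` in `S` lies in `W`.
      O≤k = begin
        ∣ O ∣                                            ≤⟨ p⊆⁅x⁆∪q⇒∣p∣≤1+∣q∣ x _ O⊆ ⟩
        1 + ∣ (S ∩ nbr E x) ─ W ∣                        ≡⟨ +-comm 1 _ ⟩
        ∣ (S ∩ nbr E x) ─ W ∣ + 1                        ≤⟨ +-monoʳ-≤ _ 1≤ ⟩
        ∣ (S ∩ nbr E x) ─ W ∣ + ∣ W ∩ nbr E x ∣          ≤⟨ ∣new∣+∣old∣≤k (W⊆S P) (O⊆S x∈O) ⟩
        k                                                ∎
      inner : ∀ {v} → v ∈ O → k ≤ 1 + ∣ O ∩ nbr E v ∣
      inner {v} v∈O = begin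
        k                                    ≤⟨ k≤d (O⊆S v∈O) ⟩
        ∣ S ∩ nbr E v ∣                      ≤⟨ ∣p∩r∣≤∣q∩r∣+∣[p─q]∩r∣ S W (nbr E v) ⟩
        ∣ W ∩ nbr E v ∣ + ∣ O ∩ nbr E v ∣    ≤⟨ +-monoˡ-≤ _ (≤1 v∈O) ⟩
        1 + ∣ O ∩ nbr E v ∣                  ∎
      inner≤ : ∀ {v} → v ∈ O → 1 + ∣ O ∩ nbr E v ∣ ≤ ∣ O ∣
      inner≤ {v} v∈O = x∈p⇒1+∣q∣≤∣p∣ _ v∈O (p∩q⊆p O (nbr E v)) (λ v∈ → nbr-irrefl E (p∩q⊆q O (nbr E v) v∈))
      1≤outer : ∀ {v} → v ∈ O → 1 ≤ ∣ (S ─ O) ∩ nbr E v ∣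
      1≤outer {v} v∈O = +-cancelˡ-≤ ∣ O ∩ nbr E v ∣ 1 _ (begin
        ∣ O ∩ nbr E v ∣ + 1                          ≡⟨ +-comm _ 1 ⟩
        1 + ∣ O ∩ nbr E v ∣                          ≤⟨ inner≤ v∈O ⟩
        ∣ O ∣                                        ≤⟨ O≤k ⟩
        k                                            ≤⟨ k≤d (O⊆S v∈O) ⟩
        ∣ S ∩ nbr E v ∣                              ≤⟨ ∣p∩r∣≤∣q∩r∣+∣[p─q]∩r∣ S O (nbr E v) ⟩
        ∣ O ∩ nbr E v ∣ + ∣ (S ─ O) ∩ nbr E v ∣      ∎)

    regular : Nonempty S → Independence≥ k E S
    regular (a , a∈S) with nonempty? (S ─ (⊥ ∪ N[ a ]))
    ... | yes more = grow _ ≤-refl (single a∈S) (a , x∈p∪q⁺ (inj₂ (x∈N[x] a))) more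
    -- If `N[ a ]` is all of `S`, then `∣ S ∣ ≤ 1 + k` and every degree is at least `k`. So `S` is a
    -- clique, and it has `1 + k` vertices, against `ω≤k`.
    ... | no none = ⊥-elim (<-irrefl refl (begin
        1 + k                    ≤⟨ s≤s (k≤d a∈S) ⟩
        1 + ∣ S ∩ nbr E a ∣      ≤⟨ x∈p⇒1+∣q∣≤∣p∣ _ a∈S (p∩q⊆p S (nbr E a)) (λ a∈ → nbr-irrefl E (p∩q⊆q S (nbr E a) a∈)) ⟩
        ∣ S ∣                    ≤⟨ ω≤k ⊆-refl (dense⇒clique E λ v∈S → ≤-trans S≤ (s≤s (≤-trans (Δ≤k a∈S) (k≤d v∈S)))) ⟩
        k                        ∎))
      where
      S⊆ : S ⊆ N[ a ]
      S⊆ {v} v∈S with v ∈? (⊥ ∪ N[ a ])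
      ... | yes v∈ = [ (λ v∈⊥ → ⊥-elim (∉⊥ v∈⊥)) , (λ v∈N → v∈N) ]′ (x∈p∪q⁻ ⊥ N[ a ] v∈)
      ... | no v∉ = ⊥-elim (none (v , x∈p∧x∉q⇒x∈p─q v∈S v∉))
      S≤ : ∣ S ∣ ≤ 1 + ∣ S ∩ nbr E a ∣
      S≤ = p⊆⁅x⁆∪q⇒∣p∣≤1+∣q∣ a _ S⊆

  brooksStep : Independence≥ k E S
  brooksStep with nonempty? S
  ... | no none = ⊥ , (λ u∈ → ⊥-elim (∉⊥ u∈)) , (λ u∈ → ⊥-elim (∉⊥ u∈)) ,
                  ≤-trans (≤-reflexive (Empty⇒∣p∣≡0 none)) z≤n
  ... | yes nonempty with any? (λ v → v ∈? S ×-dec ∣ S ∩ nbr E v ∣ <? k)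
  ...   | yes (v , v∈S , d<k) = lowDegree v∈S d<k
  ...   | no ¬low = Regular.regular (λ v∈S → ≮⇒≥ λ d<k → ¬low (_ , v∈S , d<k)) nonempty

brooks : ∀ {n k} → 3 ≤ k → (E : Adjacency n) (S : Subset n) →
         Degree≤ k E S → CliqueNumber≤ k E S → Independence≥ k E S
brooks {n} {k} 3≤k E S = go E S (<-wellFounded ∣ S ∣)
  where
  go : ∀ E S → Acc _<_ ∣ S ∣ → Degree≤ k E S → CliqueNumber≤ k E S → Independence≥ k E S
  go E S (acc rs) Δ≤k ω≤k = BrooksStep.brooksStep 3≤k E S Δ≤k ω≤k (λ E′ S′ S′<S → go E′ S′ (rs S′<S))

-- The coefficients

-- The fraction in `ℕ→ℚ m` is normalised by a gcd and does not compute for a variable `m`;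
-- identities are therefore checked on unnormalised rationals.
toℚᵘ-ℕ→ℚ : ∀ m → ℚ.toℚᵘ (ℕ→ℚ m) ℚᵘ.≃ ℚᵘ.mkℚᵘ (+ m) 0
toℚᵘ-ℕ→ℚ m = ℚ.toℚᵘ-fromℚᵘ (ℚᵘ.mkℚᵘ (+ m) 0)

ℕ→ℚ-suc : ∀ m → ℕ→ℚ (suc m) ≡ 1ℚ ℚ.+ ℕ→ℚ m
ℕ→ℚ-suc m = ℚ.toℚᵘ-injective (begin
  ℚ.toℚᵘ (ℕ→ℚ (suc m))               ≈⟨ toℚᵘ-ℕ→ℚ (suc m) ⟩
  ℚᵘ.mkℚᵘ (+ suc m) 0                ≈⟨ ℚᵘ.*≡* (cong (λ z → (+ 1 ℤ.+ z) ℤ.* + 1) (sym (ℤ.*-identityʳ (+ m)))) ⟩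
  ℚᵘ.1ℚᵘ ℚᵘ.+ ℚᵘ.mkℚᵘ (+ m) 0        ≈⟨ ℚᵘ.+-cong (ℚᵘ.≃-refl {ℚᵘ.1ℚᵘ}) (toℚᵘ-ℕ→ℚ m) ⟨
  ℚᵘ.1ℚᵘ ℚᵘ.+ ℚ.toℚᵘ (ℕ→ℚ m)         ≈⟨ ℚ.toℚᵘ-homo-+ 1ℚ (ℕ→ℚ m) ⟨
  ℚ.toℚᵘ (1ℚ ℚ.+ ℕ→ℚ m)              ∎)
  where open import Relation.Binary.Reasoning.Setoid ℚᵘ.≃-setoid

ℕ→ℚ-inverse : ∀ m → ℕ→ℚ (suc m) ℚ.* ((+ 1) ℚ./ suc m) ≡ 1ℚ
ℕ→ℚ-inverse m = ℚ.toℚᵘ-injective (begin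
  ℚ.toℚᵘ (ℕ→ℚ (suc m) ℚ.* ((+ 1) ℚ./ suc m))                  ≈⟨ ℚ.toℚᵘ-homo-* (ℕ→ℚ (suc m)) _ ⟩
  ℚ.toℚᵘ (ℕ→ℚ (suc m)) ℚᵘ.* ℚ.toℚᵘ ((+ 1) ℚ./ suc m)          ≈⟨ ℚᵘ.*-cong (toℚᵘ-ℕ→ℚ (suc m)) (ℚ.toℚᵘ-fromℚᵘ (ℚᵘ.mkℚᵘ (+ 1) m)) ⟩
  ℚᵘ.mkℚᵘ (+ suc m) 0 ℚᵘ.* ℚᵘ.mkℚᵘ (+ 1) m                    ≈⟨ ℚᵘ.*-inverseʳ (ℚᵘ.mkℚᵘ (+ suc m) 0) ⟩
  ℚ.toℚᵘ 1ℚ                                                   ∎)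
  where open import Relation.Binary.Reasoning.Setoid ℚᵘ.≃-setoid

0≤ℕ→ℚ : ∀ m → 0ℚ ≤ℚ ℕ→ℚ m
0≤ℕ→ℚ m = ℚ.nonNegative⁻¹ _ ⦃ ℚ.normalize-nonNeg m 1 ⦄

ℕ→ℚ-+ : ∀ m k → ℕ→ℚ (m + k) ≡ ℕ→ℚ m ℚ.+ ℕ→ℚ k
ℕ→ℚ-+ zero k = sym (ℚ.+-identityˡ (ℕ→ℚ k))
ℕ→ℚ-+ (suc m) k = begin
  ℕ→ℚ (suc (m + k))               ≡⟨ ℕ→ℚ-suc (m + k) ⟩
  1ℚ ℚ.+ ℕ→ℚ (m + k)              ≡⟨ cong (1ℚ ℚ.+_) (ℕ→ℚ-+ m k) ⟩
  1ℚ ℚ.+ (ℕ→ℚ m ℚ.+ ℕ→ℚ k)        ≡⟨ ℚ.+-assoc 1ℚ (ℕ→ℚ m) (ℕ→ℚ k) ⟨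
  1ℚ ℚ.+ ℕ→ℚ m ℚ.+ ℕ→ℚ k          ≡⟨ cong (ℚ._+ ℕ→ℚ k) (ℕ→ℚ-suc m) ⟨
  ℕ→ℚ (suc m) ℚ.+ ℕ→ℚ k           ∎
  where open ≡-Reasoning

ℕ→ℚ-suc-* : ∀ m x → ℕ→ℚ (suc m) ℚ.* x ≡ x ℚ.+ ℕ→ℚ m ℚ.* x
ℕ→ℚ-suc-* m x = begin
  ℕ→ℚ (suc m) ℚ.* x               ≡⟨ cong (ℚ._* x) (ℕ→ℚ-suc m) ⟩
  (1ℚ ℚ.+ ℕ→ℚ m) ℚ.* x            ≡⟨ ℚ.*-distribʳ-+ x 1ℚ (ℕ→ℚ m) ⟩
  1ℚ ℚ.* x ℚ.+ ℕ→ℚ m ℚ.* x        ≡⟨ cong (ℚ._+ ℕ→ℚ m ℚ.* x) (ℚ.*-identityˡ x) ⟩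
  x ℚ.+ ℕ→ℚ m ℚ.* x               ∎
  where open ≡-Reasoning

ℕ→ℚ-* : ∀ m k → ℕ→ℚ (m * k) ≡ ℕ→ℚ m ℚ.* ℕ→ℚ k
ℕ→ℚ-* zero k = sym (ℚ.*-zeroˡ (ℕ→ℚ k))
ℕ→ℚ-* (suc m) k = begin
  ℕ→ℚ (k + m * k)                 ≡⟨ ℕ→ℚ-+ k (m * k) ⟩
  ℕ→ℚ k ℚ.+ ℕ→ℚ (m * k)           ≡⟨ cong (ℕ→ℚ k ℚ.+_) (ℕ→ℚ-* m k) ⟩
  ℕ→ℚ k ℚ.+ ℕ→ℚ m ℚ.* ℕ→ℚ k       ≡⟨ ℕ→ℚ-suc-* m (ℕ→ℚ k) ⟨
  ℕ→ℚ (suc m) ℚ.* ℕ→ℚ k           ∎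
  where open ≡-Reasoning

x≤x+y : ∀ x {y} → 0ℚ ≤ℚ y → x ≤ℚ x ℚ.+ y
x≤x+y x {y} 0≤y = subst (_≤ℚ x ℚ.+ y) (ℚ.+-identityʳ x) (ℚ.+-monoʳ-≤ x 0≤y)

ℕ→ℚ-mono : ∀ {m k} → m ≤ k → ℕ→ℚ m ≤ℚ ℕ→ℚ k
ℕ→ℚ-mono {m} {k} m≤k with m≤n⇒∃[o]m+o≡n m≤k
... | o , refl = ℚ.≤-trans (x≤x+y (ℕ→ℚ m) (0≤ℕ→ℚ o)) (ℚ.≤-reflexive (sym (ℕ→ℚ-+ m o)))

*-monoʳ-≤ℚ : ∀ {x y} z → 0ℚ ≤ℚ z → x ≤ℚ y → x ℚ.* z ≤ℚ y ℚ.* z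
*-monoʳ-≤ℚ z 0≤z = ℚ.*-monoʳ-≤-nonNeg z ⦃ ℚ.nonNegative 0≤z ⦄

*-divℕ : ∀ m q → ℕ→ℚ (suc m) ℚ.* divℕ q (suc m) ≡ q
*-divℕ m q = begin
  ℕ→ℚ (suc m) ℚ.* (q ℚ.* i)    ≡⟨ solve 3 (λ a b d → a :* (b :* d) := b :* (a :* d)) refl (ℕ→ℚ (suc m)) q i ⟩
  q ℚ.* (ℕ→ℚ (suc m) ℚ.* i)    ≡⟨ cong (q ℚ.*_) (ℕ→ℚ-inverse m) ⟩
  q ℚ.* 1ℚ                     ≡⟨ ℚ.*-identityʳ q ⟩
  q                            ∎
  where
  open ≡-Reasoning
  open +-*-Solver
  i = (+ 1) ℚ./ suc m

c-top : ∀ {Δ} → 1 ≤ Δ → ℕ→ℚ Δ ℚ.* c Δ Δ ≡ 1ℚ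
c-top {suc m} _ rewrite n∸n≡0 m = *-divℕ m 1ℚ

c-rec : ∀ {Δ} i → suc i < Δ → ℕ→ℚ (suc i) ℚ.* c Δ (suc i) ℚ.+ c Δ (2 + i) ≡ 1ℚ
c-rec {Δ} i i<Δ = begin
  ℕ→ℚ (suc i) ℚ.* c Δ (suc i) ℚ.+ y                        ≡⟨ cong (λ t → ℕ→ℚ (suc i) ℚ.* cAux Δ t ℚ.+ y) Δ∸ ⟩
  ℕ→ℚ (suc i) ℚ.* divℕ (1ℚ ℚ.- y) (Δ ∸ suc (Δ ∸ (2 + i))) ℚ.+ y  ≡⟨ cong (λ t → ℕ→ℚ (suc i) ℚ.* divℕ (1ℚ ℚ.- y) t ℚ.+ y) back ⟩
  ℕ→ℚ (suc i) ℚ.* divℕ (1ℚ ℚ.- y) (suc i) ℚ.+ y            ≡⟨ cong (ℚ._+ y) (*-divℕ i (1ℚ ℚ.- y)) ⟩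
  1ℚ ℚ.- y ℚ.+ y                                           ≡⟨ solve 2 (λ a b → a :- b :+ b := a) refl 1ℚ y ⟩
  1ℚ                                                       ∎
  where
  open ≡-Reasoning
  open +-*-Solver
  y = c Δ (2 + i)
  -- `cAux` counts down from `Δ`: this equation exposes its recursive clause, and `back` shows that
  -- the divisor there is `suc i`, so `divℕ` does not take its default value.
  Δ∸ : Δ ∸ suc i ≡ suc (Δ ∸ (2 + i))
  Δ∸ = +-∸-assoc 1 i<Δ
  back : Δ ∸ suc (Δ ∸ (2 + i)) ≡ suc i
  back = trans (cong (Δ ∸_) (sym Δ∸)) (m∸[m∸n]≡n (<⇒≤ i<Δ))

-- The two bounds are carried together by induction downwards from `Δ`: the upper bound at one index
-- gives monotonicity there, which gives nonnegativity at the index below, and nonnegativity gives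
-- the upper bound below.
record CoefficientBounds (Δ i : ℕ) : Set where
  field
    nonneg : 0ℚ ≤ℚ c Δ i
    i*c≤1  : ℕ→ℚ i ℚ.* c Δ i ≤ℚ 1ℚ
open CoefficientBounds

bounds-top : ∀ {Δ} → 1 ≤ Δ → CoefficientBounds Δ Δ
bounds-top {suc m} 1≤Δ = record
  { nonneg = ℚ.*-cancelˡ-≤-pos (ℕ→ℚ (suc m)) ⦃ ℚ.normalize-pos (suc m) 1 ⦄
      (subst (_≤ℚ ℕ→ℚ (suc m) ℚ.* c (suc m) (suc m)) (sym (ℚ.*-zeroʳ (ℕ→ℚ (suc m)))) (subst (0ℚ ≤ℚ_) (sym (c-top 1≤Δ)) (0≤ℕ→ℚ 1)))
  ; i*c≤1 = ℚ.≤-reflexive (c-top 1≤Δ) }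

-- With `m = suc i`, `x` for the coefficient at `m` and `y` for the next one:
-- `m y = (m + 1) y - y ≤ 1 - y = m x`. Then cancel `m`.
c-decreasing : ∀ {Δ} i → suc i < Δ → CoefficientBounds Δ (2 + i) → c Δ (2 + i) ≤ℚ c Δ (suc i)
c-decreasing {Δ} i i<Δ B = ℚ.*-cancelˡ-≤-pos (ℕ→ℚ (suc i)) ⦃ ℚ.normalize-pos (suc i) 1 ⦄ (begin
  m ℚ.* y                       ≡⟨ solve 2 (λ a b → a :* b := (con 1ℚ :+ a) :* b :- b) refl m y ⟩
  (1ℚ ℚ.+ m) ℚ.* y ℚ.- y        ≡⟨ cong (λ t → t ℚ.* y ℚ.- y) (ℕ→ℚ-suc (suc i)) ⟨
  ℕ→ℚ (2 + i) ℚ.* y ℚ.- y       ≤⟨ ℚ.+-monoˡ-≤ (ℚ.- y) (i*c≤1 B) ⟩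
  1ℚ ℚ.- y                      ≡⟨ cong (ℚ._- y) (c-rec i i<Δ) ⟨
  m ℚ.* x ℚ.+ y ℚ.- y           ≡⟨ solve 2 (λ a b → a :+ b :- b := a) refl (m ℚ.* x) y ⟩
  m ℚ.* x                       ∎)
  where
  open ℚ.≤-Reasoning
  open +-*-Solver
  m = ℕ→ℚ (suc i)
  x = c Δ (suc i)
  y = c Δ (2 + i)

bounds-rec : ∀ {Δ} i → suc i < Δ → CoefficientBounds Δ (2 + i) → CoefficientBounds Δ (suc i)
bounds-rec {Δ} i i<Δ B = record
  { nonneg = ℚ.≤-trans (nonneg B) (c-decreasing i i<Δ B)
  ; i*c≤1 = ℚ.≤-trans (x≤x+y _ (nonneg B)) (ℚ.≤-reflexive (c-rec i i<Δ)) }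

bounds : ∀ {Δ} i → suc i ≤ Δ → CoefficientBounds Δ (suc i)
bounds {Δ} i i<Δ with m≤n⇒∃[o]m+o≡n i<Δ
... | t , eq = go t i eq
  where
  go : ∀ t i → suc i + t ≡ Δ → CoefficientBounds Δ (suc i)
  go zero i refl rewrite +-identityʳ i = bounds-top (s≤s z≤n)
  go (suc t) i eq = bounds-rec i
    (subst (2 + i ≤_) (trans (sym (+-suc (suc i) t)) eq) (m≤m+n (2 + i) t))
    (go t (suc i) (trans (sym (+-suc (suc i) t)) eq))

-- At index 0 the divisor is 0 and `divℕ` returns its default value 0. This makes the weight of
-- every vertex nonnegative without a case for isolated vertices.
c-zero : ∀ {Δ} → 1 ≤ Δ → c Δ 0 ≡ 0ℚ
c-zero {suc m} _ rewrite n∸n≡0 m = refl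

c-nonneg : ∀ {Δ} i → 1 ≤ Δ → i ≤ Δ → 0ℚ ≤ℚ c Δ i
c-nonneg zero 1≤Δ _ = ℚ.≤-reflexive (sym (c-zero 1≤Δ))
c-nonneg (suc i) _ i<Δ = nonneg (bounds i i<Δ)

c-antitone : ∀ {Δ} i j → suc i ≤ j → j ≤ Δ → c Δ j ≤ℚ c Δ (suc i)
c-antitone {Δ} i j i<j j≤Δ with m≤n⇒∃[o]m+o≡n i<j
... | t , refl = go t i j≤Δ
  where
  go : ∀ t i → suc i + t ≤ Δ → c Δ (suc i + t) ≤ℚ c Δ (suc i)
  go zero i _ rewrite +-identityʳ i = ℚ.≤-refl
  go (suc t) i ≤Δ = ℚ.≤-trans
    (subst (λ j → c Δ j ≤ℚ c Δ (2 + i)) (sym (+-suc (suc i) t))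
      (go t (suc i) (subst (_≤ Δ) (+-suc (suc i) t) ≤Δ)))
    (c-decreasing i i<Δ (bounds (suc i) i<Δ))
    where
    i<Δ : 2 + i ≤ Δ
    i<Δ = ≤-trans (m≤m+n (2 + i) t) (subst (_≤ Δ) (+-suc (suc i) t) ≤Δ)

-- Weighted sums over subsets

∑ : ∀ {n} → (Fin n → ℚ) → Subset n → ℚ
∑ f []          = 0ℚ
∑ f (true ∷ p)  = f zero ℚ.+ ∑ (f ∘ suc) p
∑ f (false ∷ p) = ∑ (f ∘ suc) p

∑-⊥ : ∀ {n} (f : Fin n → ℚ) → ∑ f ⊥ ≡ 0ℚ
∑-⊥ {zero} f = refl
∑-⊥ {suc n} f = ∑-⊥ (f ∘ suc)

∑-upper : ∀ {n} (f : Fin n → ℚ) p {x} → (∀ {v} → v ∈ p → f v ≤ℚ x) → ∑ f p ≤ℚ ℕ→ℚ ∣ p ∣ ℚ.* x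
∑-upper f [] {x} f≤x = ℚ.≤-reflexive (sym (ℚ.*-zeroˡ x))
∑-upper f (true ∷ p) {x} f≤x =
  ℚ.≤-trans (ℚ.+-mono-≤ (f≤x here) (∑-upper (f ∘ suc) p (f≤x ∘ there)))
    (ℚ.≤-reflexive (sym (ℕ→ℚ-suc-* ∣ p ∣ x)))
∑-upper f (false ∷ p) f≤x = ∑-upper (f ∘ suc) p (f≤x ∘ there)

∑-lower : ∀ {n} (f : Fin n → ℚ) p {x} → (∀ {v} → v ∈ p → x ≤ℚ f v) → ℕ→ℚ ∣ p ∣ ℚ.* x ≤ℚ ∑ f p
∑-lower f [] {x} x≤f = ℚ.≤-reflexive (ℚ.*-zeroˡ x)
∑-lower f (true ∷ p) {x} x≤f =
  ℚ.≤-trans (ℚ.≤-reflexive (ℕ→ℚ-suc-* ∣ p ∣ x))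
    (ℚ.+-mono-≤ (x≤f here) (∑-lower (f ∘ suc) p (x≤f ∘ there)))
∑-lower f (false ∷ p) x≤f = ∑-lower (f ∘ suc) p (x≤f ∘ there)

∑-mono : ∀ {n} (f : Fin n → ℚ) → (∀ v → 0ℚ ≤ℚ f v) → ∀ {p q} → p ⊆ q → ∑ f p ≤ℚ ∑ f q
∑-mono f 0≤f {[]} {[]} p⊆q = ℚ.≤-refl
∑-mono f 0≤f {true ∷ p} {true ∷ q} p⊆q = ℚ.+-monoʳ-≤ (f zero) (∑-mono (f ∘ suc) (0≤f ∘ suc) (drop-∷-⊆ p⊆q))
∑-mono f 0≤f {true ∷ p} {false ∷ q} p⊆q with () ← p⊆q here
∑-mono f 0≤f {false ∷ p} {true ∷ q} p⊆q = ℚ.≤-trans (∑-mono (f ∘ suc) (0≤f ∘ suc) (drop-∷-⊆ p⊆q))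
  (subst (∑ (f ∘ suc) q ≤ℚ_) (ℚ.+-comm (∑ (f ∘ suc) q) (f zero)) (x≤x+y (∑ (f ∘ suc) q) (0≤f zero)))
∑-mono f 0≤f {false ∷ p} {false ∷ q} p⊆q = ∑-mono (f ∘ suc) (0≤f ∘ suc) (drop-∷-⊆ p⊆q)

∑-disjoint : ∀ {n} (f : Fin n → ℚ) p q → Disjoint p q → ∑ f (p ∪ q) ≡ ∑ f p ℚ.+ ∑ f q
∑-disjoint f [] [] _ = refl
∑-disjoint f (true ∷ p) (true ∷ q) dis = ⊥-elim (dis here here)
∑-disjoint f (true ∷ p) (false ∷ q) dis =
  trans (cong (f zero ℚ.+_) (∑-disjoint (f ∘ suc) p q λ x∈p x∈q → dis (there x∈p) (there x∈q)))
    (sym (ℚ.+-assoc (f zero) _ _))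
∑-disjoint f (false ∷ p) (true ∷ q) dis =
  trans (cong (f zero ℚ.+_) (∑-disjoint (f ∘ suc) p q λ x∈p x∈q → dis (there x∈p) (there x∈q)))
    (solve 3 (λ a b d → a :+ (b :+ d) := b :+ (a :+ d)) refl (f zero) (∑ (f ∘ suc) p) (∑ (f ∘ suc) q))
  where open +-*-Solver
∑-disjoint f (false ∷ p) (false ∷ q) dis = ∑-disjoint (f ∘ suc) p q λ x∈p x∈q → dis (there x∈p) (there x∈q)

-- The summation loop of weightedSum is local to it and cannot be named. Abstracting suc m and ℚ._+_
-- makes the loop occur as a rigid term with distinct variable arguments, so that unification with it
-- solves the definition of partialSum.
mutual
  partialSum : ℕ → Graph → ℕ → ℚ
  partialSum = _

  weightedSum-suc : ∀ m G → weightedSum (suc m) G ≡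
                    partialSum (suc m) G m ℚ.+ c (suc m) (suc m) ℚ.* ℕ→ℚ (numDeg G (suc m))
  weightedSum-suc m G with suc m | ℚ._+_
  ... | Δ | _⊕_ = refl

-- The weighted bound

∈-tabulate⁺ : ∀ {n} {f : Fin n → Bool} {v} → f v ≡ true → v ∈ tabulate f
∈-tabulate⁺ {f = f} {v} fv = lookup⇒[]= v (tabulate f) (trans (lookup∘tabulate f v) fv)

∈-tabulate⁻ : ∀ {n} {f : Fin n → Bool} {v} → v ∈ tabulate f → f v ≡ true
∈-tabulate⁻ {f = f} {v} v∈ = trans (sym (lookup∘tabulate f v)) ([]=⇒lookup v∈)

countᵇ-tabulate : ∀ {n} {A : Set} (p : A → Bool) (f : Fin n → A) →
                  countᵇ p (List.tabulate f) ≡ ∣ tabulate (p ∘ f) ∣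
countᵇ-tabulate {zero} p f = refl
countᵇ-tabulate {suc n} p f with p (f zero)
... | true  = cong suc (countᵇ-tabulate p (f ∘ suc))
... | false = countᵇ-tabulate p (f ∘ suc)

==⇒≡ : ∀ a b → (a == b) ≡ true → a ≡ b
==⇒≡ zero zero _ = refl
==⇒≡ (suc a) (suc b) eq = cong suc (==⇒≡ a b eq)

==-refl : ∀ a → (a == a) ≡ true
==-refl zero = refl
==-refl (suc a) = ==-refl a

size≡∣∣ : ∀ {m} (p : Subset m) → size p ≡ ∣ p ∣
size≡∣∣ [] = refl
size≡∣∣ (true ∷ p) = cong suc (size≡∣∣ p)
size≡∣∣ (false ∷ p) = size≡∣∣ p

∈-allSubsets : ∀ {m} (p : Subset m) → p List.∈ allSubsets m
∈-allSubsets [] = here refl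
∈-allSubsets (true ∷ p) = ∈-++⁺ˡ (∈-map⁺ (true ∷_) (∈-allSubsets p))
∈-allSubsets {suc m} (false ∷ p) =
  ∈-++⁺ʳ (List.map (true ∷_) (allSubsets m)) (∈-map⁺ (false ∷_) (∈-allSubsets p))

x∈xs⇒x≤max : ∀ {x xs} → x List.∈ xs → x ≤ List.foldr _⊔_ 0 xs
x∈xs⇒x≤max (here refl) = m≤m⊔n _ _
x∈xs⇒x≤max (there {x = y} x∈) = ≤-trans (x∈xs⇒x≤max x∈) (m≤n⊔m y _)

foldr-∧-true : ∀ {A : Set} {f : A → Bool} (xs : List A) → (∀ x → f x ≡ true) →
               List.foldr _∧_ true (List.map f xs) ≡ true
foldr-∧-true [] _ = refl
foldr-∧-true {f = f} (x ∷ xs) all rewrite all x = foldr-∧-true xs all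

-- The given graph in terms of subsets

adjacency : (G : Graph) → Adjacency (n G)
adjacency G = record
  { nbr        = λ v → tabulate (adj G v)
  ; nbr-sym    = λ {u} {v} v∈ → ∈-tabulate⁺ (trans (Graph.sym G v u) (∈-tabulate⁻ v∈))
  ; nbr-irrefl = λ {v} v∈ → true≢false (trans (sym (∈-tabulate⁻ v∈)) (irrefl G v))
  }
  where
  true≢false : true ≢ false
  true≢false ()

deg≡∣nbr∣ : ∀ G v → deg G v ≡ ∣ nbr (adjacency G) v ∣
deg≡∣nbr∣ G v = countᵇ-tabulate (adj G v) (λ u → u)

∣S∩nbr∣≤deg : ∀ G S v → ∣ S ∩ nbr (adjacency G) v ∣ ≤ deg G v
∣S∩nbr∣≤deg G S v = ≤-trans (∣p∩q∣≤∣q∣ S (nbr (adjacency G) v)) (≤-reflexive (sym (deg≡∣nbr∣ G v)))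

independent⇒≤α : ∀ G {J} → Independent (adjacency G) J → ∣ J ∣ ≤ α G
independent⇒≤α G {J} ind = subst (_≤ α G) value
  (x∈xs⇒x≤max (∈-map⁺ (λ S → if independentᵇ G S then size S else 0) (∈-allSubsets J)))
  where
  pointwise : ∀ u v → not (lookup J u ∧ lookup J v ∧ adj G u v) ≡ true
  pointwise u v with lookup J u in Ju | lookup J v in Jv | adj G u v in uv
  ... | false | _     | _     = refl
  ... | true  | false | _     = refl
  ... | true  | true  | false = refl
  ... | true  | true  | true  =
    ⊥-elim (ind (lookup⇒[]= u J Ju) (lookup⇒[]= v J Jv) (∈-tabulate⁺ uv))
  value : (if independentᵇ G J then size J else 0) ≡ ∣ J ∣
  value rewrite foldr-∧-true {f = λ u → List.foldr _∧_ true (List.map (λ v → not (lookup J u ∧ lookup J v ∧ adj G u v)) (allFin (n G)))}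
                  (allFin (n G)) (λ u → foldr-∧-true (allFin (n G)) (pointwise u)) = size≡∣∣ J

-- The edge is the first step of the walk that leaves `M`.
boundaryEdge : ∀ {G a b} (M : Subset (n G)) → Walk G a b → a ∈ M → b ∉ M →
               ∃[ u ] ∃[ v ] u ∈ M × v ∉ M × v ∈ nbr (adjacency G) u
boundaryEdge M here a∈M b∉M = ⊥-elim (b∉M a∈M)
boundaryEdge {a = a} M (step {w = w} a~w walk) a∈M b∉M with w ∈? M
... | yes w∈M = boundaryEdge M walk w∈M b∉M
... | no  w∉M = a , w , a∈M , w∉M , ∈-tabulate⁺ a~w

minimum : ∀ {n} (f : Fin n → ℕ) {S v} → v ∈ S → ∃[ u ] u ∈ S × (∀ {w} → w ∈ S → f u ≤ f w)
minimum f {S} {v} = go v (<-wellFounded (f v))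
  where
  go : ∀ v → Acc _<_ (f v) → v ∈ S → ∃[ u ] u ∈ S × (∀ {w} → w ∈ S → f u ≤ f w)
  go v (acc rs) v∈S with any? (λ w → w ∈? S ×-dec f w <? f v)
  ... | yes (w , w∈S , fw<fv) = go w (rs fw<fv) w∈S
  ... | no  none = v , v∈S , λ w∈S → ≮⇒≥ λ fw<fv → none (_ , w∈S , fw<fv)

-- Weights by degree: the irregular and the regular case

module _ {Δ : ℕ} (G : Graph) (1≤Δ : 1 ≤ Δ) (connected : Connected G) (deg≤Δ : ∀ v → deg G v ≤ Δ) where

  private
    E = adjacency G
    N = n G

  degree= : ℕ → Subset N
  degree= i = tabulate (λ v → deg G v == i)

  degree=⁺ : ∀ i {v} → deg G v ≡ i → v ∈ degree= i
  degree=⁺ i {v} refl = ∈-tabulate⁺ (==-refl (deg G v))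

  degree=⁻ : ∀ i {v} → v ∈ degree= i → deg G v ≡ i
  degree=⁻ i v∈ = ==⇒≡ _ i (∈-tabulate⁻ v∈)

  weight : Fin N → ℚ
  weight v = c Δ (deg G v)

  weight-nonneg : ∀ v → 0ℚ ≤ℚ weight v
  weight-nonneg v = c-nonneg (deg G v) 1≤Δ (deg≤Δ v)

  -- The loop adds the degree classes one at a time. The class `suc i` is disjoint from the vertices
  -- of degree at most `i`, so each partial sum is bounded by the weight of `degree≤ i`.
  weightedSum≤∑ : weightedSum Δ G ≤ℚ ∑ weight ⊤
  weightedSum≤∑ = ℚ.≤-trans (go Δ) (∑-mono weight weight-nonneg (⊆⊤ {p = degree≤ Δ}))
    where
    degree≤ : ℕ → Subset N
    degree≤ i = tabulate (λ v → does (deg G v ≤? i))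
    does⇒ : ∀ {A : Set} (a? : Dec A) → does a? ≡ true → A
    does⇒ (yes a) _ = a
    degree≤⁻ : ∀ i {v} → v ∈ degree≤ i → deg G v ≤ i
    degree≤⁻ i {v} v∈ = does⇒ (deg G v ≤? i) (∈-tabulate⁻ v∈)
    degree≤⁺ : ∀ i {v} → deg G v ≤ i → v ∈ degree≤ i
    degree≤⁺ i {v} d≤i = ∈-tabulate⁺ (dec-true (deg G v ≤? i) d≤i)
    go : ∀ i → partialSum Δ G i ≤ℚ ∑ weight (degree≤ i)
    go zero = ℚ.≤-trans (ℚ.≤-reflexive (sym (∑-⊥ weight))) (∑-mono weight weight-nonneg (⊥⊆ {p = degree≤ 0}))
    go (suc i) = begin
      partialSum Δ G i ℚ.+ c Δ (suc i) ℚ.* ℕ→ℚ (numDeg G (suc i))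
        ≤⟨ ℚ.+-mono-≤ (go i) level ⟩
      ∑ weight (degree≤ i) ℚ.+ ∑ weight (degree= (suc i))
        ≡⟨ ∑-disjoint weight (degree≤ i) (degree= (suc i)) (λ v∈ v∈′ →
             1+n≰n (subst (_≤ i) (degree=⁻ (suc i) v∈′) (degree≤⁻ i v∈))) ⟨
      ∑ weight (degree≤ i ∪ degree= (suc i))
        ≤⟨ ∑-mono weight weight-nonneg (∪-lub (λ v∈ → degree≤⁺ (suc i) (m≤n⇒m≤1+n (degree≤⁻ i v∈)))
             (λ v∈ → degree≤⁺ (suc i) (≤-reflexive (degree=⁻ (suc i) v∈)))) ⟩
      ∑ weight (degree≤ (suc i)) ∎
      where
      open ℚ.≤-Reasoning
      level : c Δ (suc i) ℚ.* ℕ→ℚ (numDeg G (suc i)) ≤ℚ ∑ weight (degree= (suc i))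
      level = begin
        c Δ (suc i) ℚ.* ℕ→ℚ (numDeg G (suc i))
          ≡⟨ ℚ.*-comm (c Δ (suc i)) (ℕ→ℚ (numDeg G (suc i))) ⟩
        ℕ→ℚ (numDeg G (suc i)) ℚ.* c Δ (suc i)
          ≡⟨ cong (λ m → ℕ→ℚ m ℚ.* c Δ (suc i)) (countᵇ-tabulate (λ v → deg G v == suc i) (λ v → v)) ⟩
        ℕ→ℚ ∣ degree= (suc i) ∣ ℚ.* c Δ (suc i)
          ≤⟨ ∑-lower weight (degree= (suc i)) (λ v∈ → ℚ.≤-reflexive (cong (c Δ) (sym (degree=⁻ (suc i) v∈)))) ⟩
        ∑ weight (degree= (suc i)) ∎

  ∑-bound : ∀ p {m i} → suc i ≤ Δ → ∣ p ∣ ≤ m → (∀ {v} → v ∈ p → suc i ≤ deg G v) →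
            ∑ weight p ≤ℚ ℕ→ℚ m ℚ.* c Δ (suc i)
  ∑-bound p {m} {i} i<Δ ∣p∣≤m i<deg = ℚ.≤-trans
    (∑-upper weight p (λ {v} v∈p → c-antitone i (deg G v) (i<deg v∈p) (deg≤Δ v)))
    (*-monoʳ-≤ℚ (c Δ (suc i)) (c-nonneg (suc i) 1≤Δ i<Δ) (ℕ→ℚ-mono ∣p∣≤m))

  closedNbhd : Subset N → Fin N → Subset N
  closedNbhd S v = ⁅ v ⁆ ∪ (S ∩ nbr E v)

  -- The degree of `v` is a separate variable `i` so that it can be matched; degree 0 is excluded by
  -- the neighbour `u`.
  ∑-closedNbhd≤1 : ∀ S {u v i} → deg G v ≡ i → v ∈ S → (∀ {w} → w ∈ S → i ≤ deg G w) →
                   u ∈ nbr E v → ¬ (u ∈ S × deg G u ≡ i) → ∑ weight (closedNbhd S v) ≤ℚ 1ℚ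
  ∑-closedNbhd≤1 S {u} {v} {zero} dv _ _ u~v _ =
    ⊥-elim (1+n≰n (≤-trans (x∈p⇒1≤∣p∣ u~v) (≤-reflexive (trans (sym (deg≡∣nbr∣ G v)) dv))))
  ∑-closedNbhd≤1 S {u} {v} {suc i} dv v∈S min u~v u∉ with u ∈? S
  ... | no u∉S = ℚ.≤-trans (∑-bound W i<Δ ∣W∣≤ (λ w∈ → min (W⊆S w∈))) (i*c≤1 (bounds i i<Δ))
    where
    W = closedNbhd S v
    i<Δ : suc i ≤ Δ
    i<Δ = subst (_≤ Δ) dv (deg≤Δ v)
    W⊆S : W ⊆ S
    W⊆S = ∪-lub (⁅x⁆⊆ v∈S) (p∩q⊆p S _)
    ∣W∣≤ : ∣ W ∣ ≤ suc i
    -- The neighbour `u` lies outside `S`, so adding `v` to the neighbours in `S` gives no more than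
    -- `deg G v` vertices.
    ∣W∣≤ = begin
      ∣ W ∣                  ≤⟨ p⊆⁅x⁆∪q⇒∣p∣≤1+∣q∣ v (S ∩ nbr E v) ⊆-refl ⟩
      1 + ∣ S ∩ nbr E v ∣    ≤⟨ x∈p⇒1+∣q∣≤∣p∣ (S ∩ nbr E v) u~v (p∩q⊆q S _) (λ u∈ → u∉S (p∩q⊆p S _ u∈)) ⟩
      ∣ nbr E v ∣            ≡⟨ deg≡∣nbr∣ G v ⟨
      deg G v                ≡⟨ dv ⟩
      suc i                  ∎
      where open ≤-Reasoning
  ... | yes u∈S = begin
      ∑ weight W                                                ≤⟨ ∑-mono weight weight-nonneg (p⊆q∪[p─q] W ⁅ u ⁆) ⟩
      ∑ weight (⁅ u ⁆ ∪ (W ─ ⁅ u ⁆))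
        ≡⟨ ∑-disjoint weight ⁅ u ⁆ (W ─ ⁅ u ⁆) (λ x∈ x∈′ → x∈p─q⇒x∉q W ⁅ u ⁆ x∈′ x∈) ⟩
      ∑ weight ⁅ u ⁆ ℚ.+ ∑ weight (W ─ ⁅ u ⁆)                   ≤⟨ ℚ.+-mono-≤ u≤ rest≤ ⟩
      1ℚ ℚ.* c Δ (2 + i) ℚ.+ ℕ→ℚ (suc i) ℚ.* c Δ (suc i)
        ≡⟨ cong (ℚ._+ ℕ→ℚ (suc i) ℚ.* c Δ (suc i)) (ℚ.*-identityˡ (c Δ (2 + i))) ⟩
      c Δ (2 + i) ℚ.+ ℕ→ℚ (suc i) ℚ.* c Δ (suc i)               ≡⟨ ℚ.+-comm (c Δ (2 + i)) _ ⟩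
      ℕ→ℚ (suc i) ℚ.* c Δ (suc i) ℚ.+ c Δ (2 + i)               ≡⟨ c-rec i i+1<Δ ⟩
      1ℚ                                                        ∎
    where
    open ℚ.≤-Reasoning
    W = closedNbhd S v
    i<Δ : suc i ≤ Δ
    i<Δ = subst (_≤ Δ) dv (deg≤Δ v)
    W⊆S : W ⊆ S
    W⊆S = ∪-lub (⁅x⁆⊆ v∈S) (p∩q⊆p S _)
    i<du : 2 + i ≤ deg G u
    i<du = ≤∧≢⇒< (min u∈S) (λ eq → u∉ (u∈S , sym eq))
    i+1<Δ : 2 + i ≤ Δ
    i+1<Δ = ≤-trans i<du (deg≤Δ u)
    -- `W` has at most `2 + i` vertices. Without `u`, which weighs at most the next coefficient,
    -- `suc i` of them remain, as the recursion for `c` requires.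
    ∣W─u∣≤ : ∣ W ─ ⁅ u ⁆ ∣ ≤ suc i
    ∣W─u∣≤ = ≤-pred (≤-trans
      (x∈p⇒1+∣q∣≤∣p∣ (W ─ ⁅ u ⁆) (x∈p∪q⁺ (inj₂ (x∈p∩q⁺ (u∈S , u~v)))) (p─q⊆p W _) (λ u∈ → x∈p─q⇒x∉q W ⁅ u ⁆ u∈ (x∈⁅x⁆ u)))
      (≤-trans (p⊆⁅x⁆∪q⇒∣p∣≤1+∣q∣ v (S ∩ nbr E v) ⊆-refl)
        (s≤s (≤-trans (∣S∩nbr∣≤deg G S v) (≤-reflexive dv)))))
    u≤ : ∑ weight ⁅ u ⁆ ≤ℚ 1ℚ ℚ.* c Δ (2 + i)
    u≤ = ∑-bound ⁅ u ⁆ i+1<Δ (≤-reflexive (∣⁅x⁆∣≡1 u))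
      (λ w∈ → subst (λ z → 2 + i ≤ deg G z) (sym (x∈⁅y⁆⇒x≡y u w∈)) i<du)
    rest≤ : ∑ weight (W ─ ⁅ u ⁆) ≤ℚ ℕ→ℚ (suc i) ℚ.* c Δ (suc i)
    rest≤ = ∑-bound (W ─ ⁅ u ⁆) i<Δ ∣W─u∣≤ (λ w∈ → min (W⊆S (p─q⊆p W _ w∈)))

  -- The vertices of minimum degree in S are not all of V(G), so by connectedness some edge leaves them.
  exposedVertex : (∀ i → ∃[ v ] deg G v ≢ i) → ∀ S → Nonempty S →
                  ∃[ v ] ∃[ u ] v ∈ S × (∀ {w} → w ∈ S → deg G v ≤ deg G w) ×
                  u ∈ nbr E v × ¬ (u ∈ S × deg G u ≡ deg G v)
  exposedVertex irregular S (_ , s∈S) =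
    let m , m∈S , min = minimum (deg G) s∈S
        b , b≢ = irregular (deg G m)
        v , u , v∈M , u∉M , u~v = boundaryEdge (M (deg G m)) (connected m b) (∈M⁺ (m∈S , refl))
          (λ b∈M → b≢ (proj₂ (∈M⁻ b∈M)))
        v∈S , dv≡dm = ∈M⁻ v∈M
    in v , u , v∈S , (λ w∈S → ≤-trans (≤-reflexive dv≡dm) (min w∈S)) , u~v ,
       λ (u∈S , du≡dv) → u∉M (∈M⁺ (u∈S , trans du≡dv dv≡dm))
    where
    M : ℕ → Subset N
    M i = S ∩ degree= i
    ∈M⁺ : ∀ {i v} → v ∈ S × deg G v ≡ i → v ∈ M i
    ∈M⁺ {i} (v∈S , dv) = x∈p∩q⁺ (v∈S , degree=⁺ i dv)
    ∈M⁻ : ∀ {i v} → v ∈ M i → v ∈ S × deg G v ≡ i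
    ∈M⁻ {i} v∈ = let v∈S , v∈= = x∈p∩q⁻ S (degree= i) v∈ in v∈S , degree=⁻ i v∈=

  HeavyIndependent : Subset N → Set
  HeavyIndependent S = ∃[ J ] J ⊆ S × Independent E J × ∑ weight S ≤ℚ ℕ→ℚ ∣ J ∣

  -- The vertex `v` adds 1 to the size and pays for its closed neighbourhood; `J` avoids that
  -- neighbourhood, so it stays independent when `v` is added.
  insertVertex : ∀ {S v} → v ∈ S → ∑ weight (closedNbhd S v) ≤ℚ 1ℚ →
                 HeavyIndependent (S ─ closedNbhd S v) → HeavyIndependent S
  insertVertex {S} {v} v∈S W≤1 (J , J⊆ , indJ , bd) =
    ⁅ v ⁆ ∪ J , ∪-lub (⁅x⁆⊆ v∈S) J⊆S ,
    independent-insert E indJ (λ w∈J w~v → J∩W w∈J (x∈p∪q⁺ (inj₂ (x∈p∩q⁺ (J⊆S w∈J , w~v))))) ,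
    (begin
      ∑ weight S                          ≤⟨ ∑-mono weight weight-nonneg (p⊆q∪[p─q] S W) ⟩
      ∑ weight (W ∪ (S ─ W))              ≡⟨ ∑-disjoint weight W (S ─ W) (λ x∈W x∈ → x∈p─q⇒x∉q S W x∈ x∈W) ⟩
      ∑ weight W ℚ.+ ∑ weight (S ─ W)     ≤⟨ ℚ.+-mono-≤ W≤1 bd ⟩
      1ℚ ℚ.+ ℕ→ℚ ∣ J ∣                    ≡⟨ ℕ→ℚ-suc ∣ J ∣ ⟨
      ℕ→ℚ (suc ∣ J ∣)                     ≤⟨ ℕ→ℚ-mono (x∈p⇒1+∣q∣≤∣p∣ J (x∈p∪q⁺ (inj₁ (x∈⁅x⁆ v))) (q⊆p∪q ⁅ v ⁆ J)
                                               (λ v∈J → J∩W v∈J (x∈p∪q⁺ (inj₁ (x∈⁅x⁆ v))))) ⟩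
      ℕ→ℚ ∣ ⁅ v ⁆ ∪ J ∣                   ∎)
    where
    open ℚ.≤-Reasoning
    W : Subset N
    W = closedNbhd S v
    J∩W : Disjoint J W
    J∩W w∈J = x∈p─q⇒x∉q S W (J⊆ w∈J)
    J⊆S : J ⊆ S
    J⊆S w∈J = p─q⊆p S W (J⊆ w∈J)

  -- Irregularity is stated for every `i` because `exposedVertex` applies it to the minimum degree
  -- on the current `S`, which can change as `S` shrinks.
  irregular⇒ : (∀ i → ∃[ v ] deg G v ≢ i) → ∀ S → Acc _<_ ∣ S ∣ → HeavyIndependent S
  irregular⇒ irregular S (acc rs) with nonempty? S
  ... | no none = ⊥ , ⊥⊆ , (λ u∈ → ⊥-elim (∉⊥ u∈)) ,
        ℚ.≤-trans (ℚ.≤-reflexive (trans (cong (∑ weight) (Empty-unique none)) (∑-⊥ weight))) (0≤ℕ→ℚ ∣ ⊥ {N} ∣)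
  ... | yes nonempty with exposedVertex irregular S nonempty
  ...   | v , u , v∈S , min , u~v , u∉ = insertVertex v∈S (∑-closedNbhd≤1 S refl v∈S min u~v u∉)
            (irregular⇒ irregular (S ─ closedNbhd S v)
              (rs (p∩q≢∅⇒∣p─q∣<∣p∣ S (closedNbhd S v) (v , x∈p∩q⁺ (v∈S , x∈p∪q⁺ (inj₁ (x∈⁅x⁆ v)))))))

  -- In a clique on more than `Δ` vertices each vertex already has `Δ` neighbours, so no edge leaves
  -- it. By connectedness it is the whole graph, which is then complete on `suc Δ` vertices.
  cliqueNumber≤Δ : ¬ IsComplete G (suc Δ) → CliqueNumber≤ Δ E ⊤
  cliqueNumber≤Δ ¬complete {Q} _ cl = ≮⇒≥ λ Δ<∣Q∣ → ¬complete (complete Δ<∣Q∣)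
    where
    open ≤-Reasoning
    module _ (Δ<∣Q∣ : Δ < ∣ Q ∣) where
      noExit : ∀ {u v} → u ∈ Q → v ∉ Q → v ∉ nbr E u
      noExit {u} {v} u∈Q v∉Q v~u = <-irrefl refl (begin
        suc Δ                      ≤⟨ Δ<∣Q∣ ⟩
        ∣ Q ∣                      ≤⟨ p⊆⁅x⁆∪q⇒∣p∣≤1+∣q∣ u (Q ─ ⁅ u ⁆) (p⊆q∪[p─q] Q ⁅ u ⁆) ⟩
        1 + ∣ Q ─ ⁅ u ⁆ ∣          ≤⟨ x∈p⇒1+∣q∣≤∣p∣ (Q ─ ⁅ u ⁆) v~u
                                       (λ w∈ → cl u∈Q (p─q⊆p Q _ w∈) λ { refl → x∈p─q⇒x∉q Q ⁅ u ⁆ w∈ (x∈⁅x⁆ u) })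
                                       (λ v∈ → v∉Q (p─q⊆p Q _ v∈)) ⟩
        ∣ nbr E u ∣                ≡⟨ deg≡∣nbr∣ G u ⟨
        deg G u                    ≤⟨ deg≤Δ u ⟩
        Δ                          ∎)
      q∈Q = proj₂ (1≤∣p∣⇒Nonempty {p = Q} (≤-trans (s≤s z≤n) Δ<∣Q∣))
      all∈Q : ∀ v → v ∈ Q
      all∈Q v with v ∈? Q
      ... | yes v∈Q = v∈Q
      ... | no v∉Q =
        let u , w , u∈Q , w∉Q , w~u = boundaryEdge Q (connected _ v) q∈Q v∉Q
        in ⊥-elim (noExit u∈Q w∉Q w~u)
      ∣Q∣≤1+Δ : ∣ Q ∣ ≤ suc Δ
      ∣Q∣≤1+Δ = let q = proj₁ (1≤∣p∣⇒Nonempty {p = Q} (≤-trans (s≤s z≤n) Δ<∣Q∣)) in begin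
        ∣ Q ∣                      ≤⟨ p⊆⁅x⁆∪q⇒∣p∣≤1+∣q∣ q (nbr E q) (λ {v} v∈Q → Q⊆N[q] v q v∈Q) ⟩
        1 + ∣ nbr E q ∣            ≡⟨ cong suc (deg≡∣nbr∣ G q) ⟨
        1 + deg G q                ≤⟨ s≤s (deg≤Δ q) ⟩
        suc Δ                      ∎
        where
        Q⊆N[q] : ∀ v q → v ∈ Q → v ∈ ⁅ q ⁆ ∪ nbr E q
        Q⊆N[q] v q v∈Q with v ≟ᶠ q
        ... | yes refl = x∈p∪q⁺ (inj₁ (x∈⁅x⁆ v))
        ... | no v≢q = x∈p∪q⁺ (inj₂ (cl (all∈Q q) v∈Q (≢-sym v≢q)))
      complete : IsComplete G (suc Δ)
      complete =
        trans (sym (∣⊤∣≡n N)) (trans (≤-antisym (p⊆q⇒∣p∣≤∣q∣ {p = ⊤} {q = Q} (λ {v} _ → all∈Q v)) (p⊆q⇒∣p∣≤∣q∣ (⊆⊤ {p = Q})))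
          (≤-antisym ∣Q∣≤1+Δ Δ<∣Q∣)) ,
        λ u v u≢v → ∈-tabulate⁻ (cl (all∈Q u) (all∈Q v) u≢v)

  -- Every vertex has weight `c Δ Δ`, so the bound `∣ ⊤ ∣ ≤ Δ * ∣ J ∣` from `brooks` only has to be
  -- multiplied by this coefficient and simplified with `c-top`.
  regular⇒ : 3 ≤ Δ → ¬ IsComplete G (suc Δ) → (∀ v → deg G v ≡ Δ) →
             ∃[ J ] Independent E J × ∑ weight ⊤ ≤ℚ ℕ→ℚ ∣ J ∣
  regular⇒ 3≤Δ ¬complete regular =
    let J , _ , indJ , bd = brooks 3≤Δ E ⊤ (λ {v} _ → ≤-trans (∣S∩nbr∣≤deg G ⊤ v) (deg≤Δ v)) (cliqueNumber≤Δ ¬complete)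
    in J , indJ , (begin
      ∑ weight ⊤                            ≤⟨ ∑-upper weight ⊤ (λ {v} _ → ℚ.≤-reflexive (cong (c Δ) (regular v))) ⟩
      ℕ→ℚ ∣ ⊤ {N} ∣ ℚ.* c Δ Δ               ≤⟨ *-monoʳ-≤ℚ (c Δ Δ) (c-nonneg Δ 1≤Δ ≤-refl) (ℕ→ℚ-mono bd) ⟩
      ℕ→ℚ (Δ * ∣ J ∣) ℚ.* c Δ Δ             ≡⟨ cong (ℚ._* c Δ Δ) (ℕ→ℚ-* Δ ∣ J ∣) ⟩
      ℕ→ℚ Δ ℚ.* ℕ→ℚ ∣ J ∣ ℚ.* c Δ Δ         ≡⟨ solve 3 (λ a b d → a :* b :* d := b :* (a :* d)) refl (ℕ→ℚ Δ) (ℕ→ℚ ∣ J ∣) (c Δ Δ) ⟩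
      ℕ→ℚ ∣ J ∣ ℚ.* (ℕ→ℚ Δ ℚ.* c Δ Δ)       ≡⟨ cong (ℕ→ℚ ∣ J ∣ ℚ.*_) (c-top 1≤Δ) ⟩
      ℕ→ℚ ∣ J ∣ ℚ.* 1ℚ                      ≡⟨ ℚ.*-identityʳ (ℕ→ℚ ∣ J ∣) ⟩
      ℕ→ℚ ∣ J ∣                             ∎)
    where
    open ℚ.≤-Reasoning
    open +-*-Solver

theorem2 : (Δ : ℕ) → 3 ≤ Δ → (G : Graph) → InClass Δ G →
    weightedSum Δ G ≤ℚ ℕ→ℚ (α G)
theorem2 Δ 3≤Δ G (connected , (deg≤Δ , t , dt≡Δ) , ¬complete) =
  let J , indJ , bd = large in
  ℚ.≤-trans (weightedSum≤∑ G 1≤Δ connected deg≤Δ) (ℚ.≤-trans bd (ℕ→ℚ-mono (independent⇒≤α G indJ)))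
  where
  1≤Δ : 1 ≤ Δ
  1≤Δ = ≤-trans (s≤s z≤n) 3≤Δ
  large : ∃[ J ] Independent (adjacency G) J × ∑ (weight G 1≤Δ connected deg≤Δ) ⊤ ≤ℚ ℕ→ℚ ∣ J ∣
  large with any? (λ v → ¬? (deg G v ℕ.≟ Δ))
  ... | no regular = regular⇒ G 1≤Δ connected deg≤Δ 3≤Δ ¬complete
        (λ v → decidable-stable (deg G v ℕ.≟ Δ) λ dv≢Δ → regular (v , dv≢Δ))
  ... | yes (b , db≢Δ) =
    let J , _ , indJ , bd = irregular⇒ G 1≤Δ connected deg≤Δ irregular ⊤ (<-wellFounded ∣ ⊤ {n G} ∣)
    in J , indJ , bd
    where
    irregular : ∀ i → ∃[ v ] deg G v ≢ i
    -- The vertex `t` has degree `Δ` and `b` has not, so one of the two avoids any given degree `i`.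
    irregular i with i ℕ.≟ Δ
    ... | yes refl = b , db≢Δ
    ... | no  i≢Δ  = t , λ dt≡i → i≢Δ (trans (sym dt≡i) dt≡Δ)
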